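{- Let $r\geq 3$ and $n\geq 4r^2$ be integers. If $\mathcal{H}\subseteq\binom{[n]}{r}$ is a non-trivial intersecting $r$-uniform hypergraph, then $\sigma_r(\mathcal{H})\leq r\left(\binom{n-2}{r-2}-\binom{n-r-2}{r-2}\right)$.
   Context: An $r$-uniform hypergraph $\mathcal{H}\subseteq\binom{[n]}{r}$ is a family of $r$-subsets of $[n]=\{1,\dots,n\}$ (its edges). The degree $\deg(v)$ of a vertex $v$ is the number of edges containing $v$; for an $r$-set $S$, $\deg(S)=\sum_{v\in S}\deg(v)$. The Ore-degree $\sigma_r(\mathcal{H})$ is the minimum of $\deg(S)$ over all $r$-subsets $S\subseteq[n]$ with $S\notin\mathcal{H}$. $\mathcal{H}$ is intersecting if every two edges intersect. An intersecting hypergraph is trivial if it is contained in a $1$-star (the family of all $r$-subsets of $[n]$ containing a fixed vertex), i.e. all edges share a common vertex; otherwise it is non-trivial. -}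

module Defs where

open import Data.Nat using (ℕ; _+_; _≤_)
open import Data.Fin using (Fin)
open import Data.Fin.Subset using (Subset; _∈_; _∉_; ∣_∣; _∩_; Nonempty)
open import Data.Fin.Subset.Properties using (_∈?_)
open import Data.List using (List; []; _∷_; length; filter; foldr)
open import Data.List.Relation.Unary.All using (All)
open import Data.List.Relation.Unary.Unique.Propositional using (Unique)
import Data.List.Membership.Propositional as LM
open import Data.Product using (Σ; _×_; ∃)
open import Relation.Binary.PropositionalEquality using (_≡_)
open import Relation.Nullary using (¬_)

record Hypergraph (n r : ℕ) : Set where
  field
    edges   : List (Subset n)
    unique  : Unique edges
    uniform : All (λ e → ∣ e ∣ ≡ r) edges
open Hypergraph public

_∈E_ : ∀ {n r} → Subset n → Hypergraph n r → Set
S ∈E H = S LM.∈ edges H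

deg : ∀ {n r} → Hypergraph n r → Fin n → ℕ
deg H v = length (filter (v ∈?_) (edges H))

degSet : ∀ {n r} → Hypergraph n r → Subset n → ℕ
degSet {n} H S = go (Data.List.allFin n)
  where
  go : List (Fin n) → ℕ
  go [] = 0
  go (v ∷ vs) with v ∈? S
  ... | Relation.Nullary.yes _ = deg H v + go vs
  ... | Relation.Nullary.no  _ = go vs

-- σ_r(H) ≤ b  : the minimum of deg(S) over r-subsets S ∉ H is at most b,
-- i.e. some r-subset S that is not an edge has deg(S) ≤ b.
OreDegree≤ : ∀ {n r} → Hypergraph n r → ℕ → Set
OreDegree≤ {n} {r} H b =
  Σ (Subset n) λ S → (∣ S ∣ ≡ r) × (¬ (S ∈E H)) × (degSet H S ≤ b)

Intersecting : ∀ {n r} → Hypergraph n r → Set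
Intersecting H = ∀ {e f} → e ∈E H → f ∈E H → Nonempty (e ∩ f)

Trivial : ∀ {n r} → Hypergraph n r → Set
Trivial {n} H = Σ (Fin n) λ v → ∀ {e} → e ∈E H → v ∈ e

NonTrivial : ∀ {n r} → Hypergraph n r → Set
NonTrivial H = ¬ Trivial H

{-# OPTIONS --safe #-}
module Submission where

-- Let N and M be the numbers of r-sets through 3 and 2 given points, and D the bound divided by r.
-- It suffices to find T containing an edge A such that the vertices outside T have average degree
-- at most D: the r of them with smallest degrees then form a set of degree at most r D, which is
-- not an edge because it misses A.
-- A pair of vertices that is missed by some edge f has codegree at most r N, as every edge through
-- the pair also meets f. So consider the graph of the covering pairs, those met by every edge.
-- * Triangle a b c: every edge contains two of a, b, c, so other vertices have degree ≤ 3 N ≤ D.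
-- * Path a v b with a b not covering: the edges missing v contain a and b, so there are at most
--   r N of them. Let A be one. If it is the only one, vertices outside A ∪ {v} have degree ≤ D.
--   If B is another one, the r-sets through u, v and some x ∈ A ∖ B that avoid B are lost from the
--   degree of u, which outweighs the contribution of the edges missing v.
-- * Isolated covering pair a b: deg a and deg b are at most M + r² N, so there are at most
--   2 (M + r² N) edges, and T can be chosen such that every edge meets it twice.
-- * No covering pair: growing a set R greedily, by a vertex of an edge missed by R, gives a cover K
--   contained in at least a fraction r ^ (- |K|) of the edges considered. If there were more
--   than 3 r² N edges, applying this to all edges and to the edges missing a vertex x would give
--   covers of size at most √(3 r); branching along them bounds the number of edges by 3 r² N.

open import Defs
open import Data.Bool using (Bool; true; false)
import Data.Bool.Properties as Bool
open import Data.Fin using (Fin; zero; suc)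
open import Data.Fin.Properties using (_≟_; any?)
open import Data.Fin.Subset
open import Data.Fin.Subset.Properties
open import Data.List using (List; []; _∷_; length; filter; allFin; tabulate)
import Data.List.Membership.Propositional as LM
open import Data.List.Relation.Unary.All using ([]; _∷_)
import Data.List.Relation.Unary.All as All
open import Data.List.Relation.Unary.All.Properties using (¬All⇒Any¬)
open import Data.List.Relation.Unary.AllPairs using ([]; _∷_)
import Data.List.Relation.Unary.Any as Any
open import Data.List.Relation.Unary.Any using (here; there)
open import Data.List.Relation.Unary.Unique.Propositional using (Unique)
open import Data.Nat
  using (ℕ; zero; suc; _+_; _*_; _∸_; _^_; _≤_; _<_; z≤n; s≤s; NonZero; >-nonZero)
open import Data.Nat.Combinatorics
  using (_C_; nCk+nC[k+1]≡[n+1]C[k+1]; k>n⇒nCk≡0; nCk≡nC[n∸k]; nCn≡1)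
open import Data.Nat.Properties hiding (_≟_)
open import Data.Nat.Tactic.RingSolver using (solve-∀)
open import Data.Product using (_×_; _,_; ∃; proj₁)
open import Data.Sum using (_⊎_; inj₁; inj₂; [_,_]′)
open import Data.Vec using ([]; _∷_; here; there; lookup; _[_]≔_)
open import Data.Vec.Properties using ([]=⇒lookup; lookup⇒[]=; ≡-dec)
open import Function using (_∘_; const; case_of_)
open import Relation.Binary.PropositionalEquality
  using (_≡_; _≢_; refl; sym; trans; cong; cong₂; subst; subst₂; ≢-sym)
open import Relation.Nullary using (¬_; Dec; yes; no; contradiction; ¬?; _×-dec_)
open import Relation.Nullary.Decidable using (map′)

-- Binomial coefficients

nC0≡1 : ∀ n → n C 0 ≡ 1
nC0≡1 n = trans (nCk≡nC[n∸k] {0} {n} z≤n) (nCn≡1 n)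

-- Both sides expand by Pascal's rule. The identity turns quotients of neighbouring binomials into
-- quotients of their parameters.
absorption : ∀ n k → suc k * (suc n C suc k) ≡ suc n * (n C k)
absorption zero zero = refl
absorption zero (suc k) =
  trans (cong (suc (suc k) *_) (k>n⇒nCk≡0 {1} {suc (suc k)} (s≤s (s≤s z≤n))))
        (trans (*-zeroʳ (suc (suc k)))
               (sym (trans (*-identityˡ _) (k>n⇒nCk≡0 {0} {suc k} (s≤s z≤n)))))
absorption (suc n) zero = begin-equality
  1 * (suc (suc n) C 1)            ≡⟨ cong (1 *_) (nCk+nC[k+1]≡[n+1]C[k+1] (suc n) 0) ⟨
  1 * (suc n C 0 + suc n C 1)      ≡⟨ expand (suc n C 0) (suc n C 1) ⟩
  suc n C 0 + 1 * (suc n C 1)      ≡⟨ cong (suc n C 0 +_) (absorption n 0) ⟩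
  suc n C 0 + suc n * (n C 0)      ≡⟨ cong (λ z → suc n C 0 + suc n * z) (trans (nC0≡1 n) (sym (nC0≡1 (suc n)))) ⟩
  suc (suc n) * (suc n C 0)        ∎
  where
  open ≤-Reasoning
  expand : ∀ a b → 1 * (a + b) ≡ a + 1 * b
  expand = solve-∀
absorption (suc n) (suc k) = begin-equality
  suc (suc k) * (suc (suc n) C suc (suc k))
    ≡⟨ cong (suc (suc k) *_) (nCk+nC[k+1]≡[n+1]C[k+1] (suc n) (suc k)) ⟨
  suc (suc k) * (a + b)
    ≡⟨ expand k a b ⟩
  a + suc k * a + suc (suc k) * b
    ≡⟨ cong₂ (λ x y → a + x + y) (absorption n k) (absorption n (suc k)) ⟩
  a + suc n * (n C k) + suc n * (n C suc k)
    ≡⟨ collect n a (n C k) (n C suc k) ⟩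
  a + suc n * (n C k + n C suc k)
    ≡⟨ cong (λ z → a + suc n * z) (nCk+nC[k+1]≡[n+1]C[k+1] n k) ⟩
  suc (suc n) * a ∎
  where
  open ≤-Reasoning
  a = suc n C suc k
  b = suc n C suc (suc k)
  expand : ∀ k a b → suc (suc k) * (a + b) ≡ a + suc k * a + suc (suc k) * b
  expand = solve-∀
  collect : ∀ n a x y → a + suc n * x + suc n * y ≡ a + suc n * (x + y)
  collect = solve-∀

C-stepˡ : ∀ n k → n C k ≤ suc n C k
C-stepˡ n zero = ≤-reflexive (trans (nC0≡1 n) (sym (nC0≡1 (suc n))))
C-stepˡ n (suc k) = begin
  n C suc k           ≤⟨ m≤n+m _ (n C k) ⟩
  n C k + n C suc k   ≡⟨ nCk+nC[k+1]≡[n+1]C[k+1] n k ⟩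
  suc n C suc k       ∎
  where open ≤-Reasoning

C-monoˡ : ∀ p q k → q C k ≤ (p + q) C k
C-monoˡ zero q k = ≤-refl
C-monoˡ (suc p) q k = ≤-trans (C-monoˡ p q k) (C-stepˡ (p + q) k)

-- By Pascal's rule the difference of the two outer binomials is a sum of `p` terms `i C k` with
-- `q ≤ i < p + q`, each at least `q C k`.
C-growth-≥ : ∀ p q k → p * (q C k) + q C suc k ≤ (p + q) C suc k
C-growth-≥ zero q k = ≤-refl
C-growth-≥ (suc p) q k = begin
  q C k + p * (q C k) + q C suc k     ≡⟨ +-assoc (q C k) _ _ ⟩
  q C k + (p * (q C k) + q C suc k)   ≤⟨ +-mono-≤ (C-monoˡ p q k) (C-growth-≥ p q k) ⟩
  (p + q) C k + (p + q) C suc k       ≡⟨ nCk+nC[k+1]≡[n+1]C[k+1] (p + q) k ⟩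
  suc (p + q) C suc k                 ∎
  where open ≤-Reasoning

-- The same `p` terms, now bounded from above. A fixed `m` in place of `p + q - 1` stays unchanged
-- during the induction on `p`.
C-growth-≤ : ∀ p q k {m} → p + q ≤ suc m → (p + q) C suc k ≤ q C suc k + p * (m C k)
C-growth-≤ zero q k _ = m≤m+n _ _
C-growth-≤ (suc p) q k {m} (s≤s p+q≤m) = begin
  suc (p + q) C suc k                 ≡⟨ nCk+nC[k+1]≡[n+1]C[k+1] (p + q) k ⟨
  (p + q) C k + (p + q) C suc k
    ≤⟨ +-mono-≤ (subst (λ z → (p + q) C k ≤ z C k) (m∸n+n≡m p+q≤m) (C-monoˡ (m ∸ (p + q)) (p + q) k))
                (C-growth-≤ p q k (m≤n⇒m≤1+n p+q≤m)) ⟩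
  m C k + (q C suc k + p * (m C k))   ≡⟨ rearrange (m C k) (q C suc k) _ ⟩
  q C suc k + suc p * (m C k)         ∎
  where
  open ≤-Reasoning
  rearrange : ∀ a b c → a + (b + c) ≡ b + (a + c)
  rearrange = solve-∀

-- Removing `p` of `p + q` points destroys at most a fraction `p * j / (p + q)` of the `j`-sets:
-- absorption rewrites the loss term of `C-growth-≤`.
C-shift-loss : ∀ p q j →
  (p + q) * ((p + q) C j) ≤ (p + q) * (q C j) + p * (j * ((p + q) C j))
C-shift-loss p q zero rewrite nC0≡1 (p + q) | nC0≡1 q = m≤m+n _ _
C-shift-loss p q (suc j) with p + q in eq
... | zero = z≤n
... | suc m = begin
  suc m * (suc m C suc j)
    ≤⟨ *-monoʳ-≤ (suc m) (subst (λ z → z C suc j ≤ q C suc j + p * (m C j)) eq (C-growth-≤ p q j (≤-reflexive eq))) ⟩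
  suc m * (q C suc j + p * (m C j))
    ≡⟨ distrib m (q C suc j) p (m C j) ⟩
  suc m * (q C suc j) + p * (suc m * (m C j))
    ≡⟨ cong (λ z → suc m * (q C suc j) + p * z) (absorption m j) ⟨
  suc m * (q C suc j) + p * (suc j * (suc m C suc j)) ∎
  where
  open ≤-Reasoning
  distrib : ∀ m a p b → suc m * (a + p * b) ≡ suc m * a + p * (suc m * b)
  distrib = solve-∀

-- `C-shift-loss` with the lost fraction bounded by `d / c`, cleared of denominators.
C-ratio : ∀ c d p q j → 0 < p + q → c * (p * j) ≤ d * (p + q) →
  c * ((p + q) C j) ≤ c * (q C j) + d * ((p + q) C j)
C-ratio c d p q j 0<m cpj≤dm = *-cancelˡ-≤ m {{>-nonZero 0<m}} (begin
  m * (c * N)                        ≡⟨ swap m c N ⟩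
  c * (m * N)                        ≤⟨ *-monoʳ-≤ c (C-shift-loss p q j) ⟩
  c * (m * L + p * (j * N))          ≡⟨ distrib c m L p j N ⟩
  m * (c * L) + (c * (p * j)) * N    ≤⟨ +-monoʳ-≤ (m * (c * L)) (*-monoˡ-≤ N cpj≤dm) ⟩
  m * (c * L) + (d * m) * N          ≡⟨ collect m c L d N ⟩
  m * (c * L + d * N)                ∎)
  where
  open ≤-Reasoning
  m = p + q
  N = m C j
  L = q C j
  swap : ∀ a b c → a * (b * c) ≡ b * (a * c)
  swap = solve-∀
  distrib : ∀ c m l p j n → c * (m * l + p * (j * n)) ≡ m * (c * l) + (c * (p * j)) * n
  distrib = solve-∀
  collect : ∀ m c l d n → m * (c * l) + (d * m) * n ≡ m * (c * l + d * n)
  collect = solve-∀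

-- The r-sets through 2 points, through 3 points, and through 3 points but avoiding an r-set.
pairs triples avoiding degreeBound : ℕ → ℕ → ℕ
pairs       n r = (n ∸ 2) C (r ∸ 2)
triples     n r = (n ∸ 3) C (r ∸ 3)
avoiding    n r = (n ∸ r ∸ 3) C (r ∸ 3)
degreeBound n r = (n ∸ 2) C (r ∸ 2) ∸ (n ∸ r ∸ 2) C (r ∸ 2)

-- Numerical estimates for n ≥ 4 r²

slack : ∀ {a b} s → a + s ≡ b → a ≤ b
slack {a} s refl = m≤m+n a s

-- r = 3 + j and n = 4 r² + t, with q = n − r − 3 expressed in terms of j and t.
data Large : ℕ → ℕ → Set where
  large : ∀ j q t → q ≡ 30 + 23 * j + 4 * (j * j) + t → Large (3 + j) (3 + (3 + j + q))

mkLarge : ∀ {r n} → 3 ≤ r → 4 * r ^ 2 ≤ n → Large r n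
mkLarge {suc (suc (suc j))} {n} (s≤s (s≤s (s≤s z≤n))) 4r²≤n =
  subst (Large (3 + j)) (trans (normal j (n ∸ 4 * (3 + j) ^ 2)) (m+[n∸m]≡n 4r²≤n)) (large j _ (n ∸ 4 * (3 + j) ^ 2) refl)
  where
  normal : ∀ j t → 3 + (3 + j + (30 + 23 * j + 4 * (j * j) + t)) ≡ 4 * ((3 + j) * ((3 + j) * 1)) + t
  normal = solve-∀

3≤r : ∀ {r n} → Large r n → 3 ≤ r
3≤r (large j _ _ _) = s≤s (s≤s (s≤s z≤n))

pairs-triples : ∀ {r n} → Large r n → (r ∸ 2) * pairs n r ≡ (n ∸ 2) * triples n r
pairs-triples (large j _ _ _) = absorption _ j

n∸r≡3+q : ∀ j q → 3 + (3 + j + q) ∸ (3 + j) ≡ 3 + q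
n∸r≡3+q j q = trans (cong (_∸ (3 + j)) (shuffle j q)) (m+n∸m≡n (3 + j) (3 + q))
  where
  shuffle : ∀ j q → 3 + (3 + j + q) ≡ 3 + j + (3 + q)
  shuffle = solve-∀

-- The difference defining `degreeBound` is at least `r * Q`, and `Q` falls short of `N` by at most
-- a fraction (r - 3) / (4 r). The factor 3 (r + 1) is 4 r - (r - 3).
degreeBound-≥ : ∀ {r n} → Large r n → 3 * (r + 1) * triples n r ≤ 4 * degreeBound n r
degreeBound-≥ (large j q t q≡) = begin
  3 * (3 + j + 1) * N            ≤⟨ +-cancelʳ-≤ (j * N) _ _ ratio ⟩
  4 * (3 + j) * Q                ≡⟨ *-assoc 4 (3 + j) Q ⟩
  4 * ((3 + j) * Q)              ≤⟨ *-monoʳ-≤ 4 growth ⟩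
  4 * degreeBound (3 + (3 + j + q)) (3 + j) ∎
  where
  open ≤-Reasoning
  N = (3 + j + q) C j
  Q = (1 + q) C j
  shift : ∀ j q → 2 + j + (1 + q) ≡ 3 + j + q
  shift = solve-∀
  poly : ∀ {q} t → q ≡ 30 + 23 * j + 4 * (j * j) + t →
    4 * (3 + j) * ((2 + j) * j) ≤ j * (2 + j + (1 + q))
  poly t refl = slack _ (identity j t)
    where
    identity : ∀ j t → 4 * (3 + j) * ((2 + j) * j) + j * (9 + 4 * j + t)
             ≡ j * (2 + j + (1 + (30 + 23 * j + 4 * (j * j) + t)))
    identity = solve-∀
  split : ∀ j N → 3 * (3 + j + 1) * N + j * N ≡ 4 * (3 + j) * N
  split = solve-∀
  ratio : 3 * (3 + j + 1) * N + j * N ≤ 4 * (3 + j) * Q + j * N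
  ratio = begin
    3 * (3 + j + 1) * N + j * N  ≡⟨ split j N ⟩
    4 * (3 + j) * N
      ≤⟨ subst (λ m → 4 * (3 + j) * (m C j) ≤ 4 * (3 + j) * Q + j * (m C j)) (shift j q)
           (C-ratio (4 * (3 + j)) j (2 + j) (1 + q) j (s≤s z≤n) (poly t q≡)) ⟩
    4 * (3 + j) * Q + j * N      ∎
  growth : (3 + j) * Q ≤ degreeBound (3 + (3 + j + q)) (3 + j)
  growth = subst (λ s → (3 + j) * Q ≤ (4 + j + q) C (1 + j) ∸ (s ∸ 2) C (1 + j)) (sym (n∸r≡3+q j q))
    (m+n≤o⇒m≤o∸n ((3 + j) * Q)
      (subst (λ m → (3 + j) * Q + (1 + q) C (1 + j) ≤ m C (1 + j)) (+-suc (3 + j) q)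
        (C-growth-≥ (3 + j) (1 + q) j)))

-- Forbidding `r` further points loses at most a fraction r (r - 3) / (n - 3) ≤ 1/4.
avoiding-≥ : ∀ {r n} → Large r n → 3 * triples n r ≤ 4 * avoiding n r
avoiding-≥ (large j q t q≡) = subst (λ s → 3 * N ≤ 4 * ((s ∸ 3) C j)) (sym (n∸r≡3+q j q))
  (+-cancelʳ-≤ (1 * N) _ _ (begin
    3 * N + 1 * N   ≡⟨ split N ⟩
    4 * N           ≤⟨ C-ratio 4 1 (3 + j) q j (s≤s z≤n) (poly t q≡) ⟩
    4 * (q C j) + 1 * N ∎))
  where
  open ≤-Reasoning
  N = (3 + j + q) C j
  split : ∀ N → 3 * N + 1 * N ≡ 4 * N
  split = solve-∀
  poly : ∀ {q} t → q ≡ 30 + 23 * j + 4 * (j * j) + t → 4 * ((3 + j) * j) ≤ 1 * (3 + j + q)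
  poly t refl = slack _ (identity j t)
    where
    identity : ∀ j t → 4 * ((3 + j) * j) + (33 + 12 * j + t)
             ≡ 1 * (3 + j + (30 + 23 * j + 4 * (j * j) + t))
    identity = solve-∀

-- The subtraction in `degreeBound` does not truncate, so upper bounds by it can be proved
-- additively.
avoiding-pairs : ∀ {r n} → Large r n → (n ∸ r ∸ 2) C (r ∸ 2) + degreeBound n r ≡ pairs n r
avoiding-pairs (large j q _ _) =
  m+[n∸m]≡n (subst (λ s → (s ∸ 2) C (1 + j) ≤ (4 + j + q) C (1 + j)) (sym (n∸r≡3+q j q))
    (subst (λ m → (1 + q) C (1 + j) ≤ m C (1 + j)) (+-suc (3 + j) q) (C-monoˡ (3 + j) (1 + q) (1 + j))))

triples≤degreeBound : ∀ {r n} → Large r n → 3 * triples n r ≤ degreeBound n r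
triples≤degreeBound {r} {n} r-n = *-cancelˡ-≤ 4 (begin
  4 * (3 * N)       ≡⟨ *-assoc 4 3 N ⟨
  3 * 4 * N         ≤⟨ *-monoˡ-≤ N (*-monoʳ-≤ 3 (+-monoˡ-≤ 1 (3≤r r-n))) ⟩
  3 * (r + 1) * N   ≤⟨ degreeBound-≥ r-n ⟩
  4 * degreeBound n r ∎)
  where
  open ≤-Reasoning
  N = triples n r

-- In the three averaging estimates `c` is the number of vertices outside the set `T` of the case at
-- hand. Once all terms are multiples of `triples n r`, a polynomial inequality in `r` and `n`
-- remains.
star-average : ∀ {r n} c → Large r n → n ≤ c + (2 * r + 1) →
  (r ∸ 2) * (r * triples n r) ≤ c * avoiding n r
star-average {r} {n} c r-n n≤c+ = *-cancelˡ-≤ 4 (begin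
  4 * ((r ∸ 2) * (r * N))  ≡⟨ assoc (r ∸ 2) r N ⟩
  4 * ((r ∸ 2) * r) * N    ≤⟨ *-monoˡ-≤ N (c≥ r-n n≤c+) ⟩
  c * 3 * N                ≡⟨ *-assoc c 3 N ⟩
  c * (3 * N)              ≤⟨ *-monoʳ-≤ c (avoiding-≥ r-n) ⟩
  c * (4 * L)              ≡⟨ swap c L ⟩
  4 * (c * L)              ∎)
  where
  open ≤-Reasoning
  N = triples n r
  L = avoiding n r
  c≥ : ∀ {r n} → Large r n → n ≤ c + (2 * r + 1) → 4 * ((r ∸ 2) * r) ≤ c * 3
  c≥ (large j _ t refl) n≤ = ≤-trans (slack _ (poly′ j t)) (*-monoˡ-≤ 3 c≥′)
    where
    poly : ∀ j t → (29 + 22 * j + 4 * (j * j) + t) + (2 * (3 + j) + 1)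
         ≡ 3 + (3 + j + (30 + 23 * j + 4 * (j * j) + t))
    poly = solve-∀
    poly′ : ∀ j t → 4 * ((1 + j) * (3 + j)) + (75 + 50 * j + 8 * (j * j) + 3 * t)
          ≡ (29 + 22 * j + 4 * (j * j) + t) * 3
    poly′ = solve-∀
    c≥′ : 29 + 22 * j + 4 * (j * j) + t ≤ c
    c≥′ = +-cancelʳ-≤ (2 * (3 + j) + 1) _ _ (≤-trans (≤-reflexive (poly j t)) n≤)
  swap : ∀ c L → c * (4 * L) ≡ 4 * (c * L)
  swap = solve-∀
  assoc : ∀ a b N → 4 * (a * (b * N)) ≡ 4 * (a * b) * N
  assoc = solve-∀

kernel-average : ∀ {r n} c → Large r n → n ≤ c + 2 * r →
  (r ∸ 2) * (2 * (pairs n r + r * (r * triples n r))) ≤ c * degreeBound n r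
kernel-average {r} {n} c r-n n≤c+ = *-cancelˡ-≤ 4 (begin
  4 * ((r ∸ 2) * (2 * (M + r * (r * N))))          ≡⟨ expand (r ∸ 2) M r N ⟩
  -- The factor `r ∸ 2` is what converts `M` into a multiple of `N`.
  8 * ((r ∸ 2) * M) + 8 * (r ∸ 2) * (r * r) * N    ≡⟨ cong (λ z → 8 * z + 8 * (r ∸ 2) * (r * r) * N) (pairs-triples r-n) ⟩
  8 * ((n ∸ 2) * N) + 8 * (r ∸ 2) * (r * r) * N    ≡⟨ collect (n ∸ 2) N (r ∸ 2) (r * r) ⟩
  8 * ((n ∸ 2) + (r ∸ 2) * (r * r)) * N            ≤⟨ *-monoˡ-≤ N (c≥ r-n n≤c+) ⟩
  c * (3 * (r + 1)) * N                            ≡⟨ *-assoc c _ N ⟩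
  c * (3 * (r + 1) * N)                            ≤⟨ *-monoʳ-≤ c (degreeBound-≥ r-n) ⟩
  c * (4 * degreeBound n r)                        ≡⟨ swap c _ ⟩
  4 * (c * degreeBound n r)                        ∎)
  where
  open ≤-Reasoning
  N = triples n r
  M = pairs n r
  expand : ∀ s M r N → 4 * (s * (2 * (M + r * (r * N)))) ≡ 8 * (s * M) + 8 * s * (r * r) * N
  expand = solve-∀
  collect : ∀ m N s x → 8 * (m * N) + 8 * s * x * N ≡ 8 * (m + s * x) * N
  collect = solve-∀
  swap : ∀ c L → c * (4 * L) ≡ 4 * (c * L)
  swap = solve-∀
  c≥ : ∀ {r n} → Large r n → n ≤ c + 2 * r → 8 * ((n ∸ 2) + (r ∸ 2) * (r * r)) ≤ c * (3 * (r + 1))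
  c≥ (large j _ t refl) n≤ = ≤-trans (slack _ (poly′ j t)) (*-monoˡ-≤ (3 * (3 + j + 1)) c≥′)
    where
    poly : ∀ j t → (30 + 22 * j + 4 * (j * j) + t) + 2 * (3 + j)
         ≡ 3 + (3 + j + (30 + 23 * j + 4 * (j * j) + t))
    poly = solve-∀
    poly′ : ∀ j t → 8 * ((1 + (3 + j + (30 + 23 * j + 4 * (j * j) + t))) + (1 + j) * ((3 + j) * (3 + j)))
          + (16 + 42 * j + 26 * (j * j) + 4 * (j * (j * j)) + (4 * t + 3 * (j * t)))
          ≡ (30 + 22 * j + 4 * (j * j) + t) * (3 * (3 + j + 1))
    poly′ = solve-∀
    c≥′ : 30 + 22 * j + 4 * (j * j) + t ≤ c
    c≥′ = +-cancelʳ-≤ (2 * (3 + j)) _ _ (≤-trans (≤-reflexive (poly j t)) n≤)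

kernelless-average : ∀ {r n} c → Large r n → n ≤ c + r →
  (r ∸ 1) * (3 * (r * (r * triples n r))) ≤ c * degreeBound n r
kernelless-average {r} {n} c r-n n≤c+ = *-cancelˡ-≤ 4 (begin
  4 * ((r ∸ 1) * (3 * (r * (r * N))))    ≡⟨ expand (r ∸ 1) r N ⟩
  12 * ((r ∸ 1) * (r * r)) * N           ≤⟨ *-monoˡ-≤ N (c≥ r-n n≤c+) ⟩
  c * (3 * (r + 1)) * N                  ≡⟨ *-assoc c _ N ⟩
  c * (3 * (r + 1) * N)                  ≤⟨ *-monoʳ-≤ c (degreeBound-≥ r-n) ⟩
  c * (4 * degreeBound n r)              ≡⟨ swap c _ ⟩
  4 * (c * degreeBound n r)              ∎)
  where
  open ≤-Reasoning
  N = triples n r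
  expand : ∀ s r N → 4 * (s * (3 * (r * (r * N)))) ≡ 12 * (s * (r * r)) * N
  expand = solve-∀
  swap : ∀ c L → c * (4 * L) ≡ 4 * (c * L)
  swap = solve-∀
  c≥ : ∀ {r n} → Large r n → n ≤ c + r → 12 * ((r ∸ 1) * (r * r)) ≤ c * (3 * (r + 1))
  c≥ (large j _ t refl) n≤ = ≤-trans (slack _ (poly′ j t)) (*-monoˡ-≤ (3 * (3 + j + 1)) c≥′)
    where
    poly : ∀ j t → (33 + 23 * j + 4 * (j * j) + t) + (3 + j)
         ≡ 3 + (3 + j + (30 + 23 * j + 4 * (j * j) + t))
    poly = solve-∀
    poly′ : ∀ j t → 12 * ((2 + j) * ((3 + j) * (3 + j)))
          + (180 + 123 * j + 21 * (j * j) + (12 * t + 3 * (j * t)))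
          ≡ (33 + 23 * j + 4 * (j * j) + t) * (3 * (3 + j + 1))
    poly′ = solve-∀
    c≥′ : 33 + 23 * j + 4 * (j * j) + t ≤ c
    c≥′ = +-cancelʳ-≤ (3 + j) _ _ (≤-trans (≤-reflexive (poly j t)) n≤)

-- By absorption the quotient is (n - i) / (r - i), which is at least n / r ≥ 4 r.
C-diagonal-decay : ∀ {r n} → Large r n → ∀ i → i < r →
  4 * r * ((n ∸ suc i) C (r ∸ suc i)) ≤ (n ∸ i) C (r ∸ i)
C-diagonal-decay {r} {n} r-n i i<r
  with r ∸ i | r ∸ suc i | n ∸ i | n ∸ suc i | +-∸-assoc 1 i<r | +-∸-assoc 1 (i<n r-n i<r) | m∸n+n≡m (<⇒≤ i<r) | m∸n+n≡m (<⇒≤ (i<n r-n i<r))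
  where
  i<n : ∀ {r n i} → Large r n → i < r → i < n
  i<n (large j _ _ _) i<r = ≤-trans i<r (≤-trans (m≤m+n (3 + j) _) (m≤n+m _ 3))
-- Matching the equations turns `r` into `suc a + i` and `n` into `suc b + i`.
... | _ | a | _ | b | refl | refl | refl | refl = *-cancelˡ-≤ (suc a) (begin
  suc a * (4 * (suc a + i) * (b C a))    ≡⟨ shuffle a i (b C a) ⟩
  suc a * (4 * (suc a + i)) * (b C a)    ≤⟨ *-monoˡ-≤ (b C a) (+-cancelʳ-≤ i _ _ rn) ⟩
  suc b * (b C a)                        ≡⟨ absorption b a ⟨
  suc a * (suc b C suc a)                ∎)
  where
  open ≤-Reasoning
  shuffle : ∀ a i x → suc a * (4 * (suc a + i) * x) ≡ suc a * (4 * (suc a + i)) * x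
  shuffle = solve-∀
  4r²≤n : ∀ {r n} → Large r n → 4 * (r * r) ≤ n
  4r²≤n (large j _ t refl) = slack t (poly j t)
    where
    poly : ∀ j t → 4 * ((3 + j) * (3 + j)) + t ≡ 3 + (3 + j + (30 + 23 * j + 4 * (j * j) + t))
    poly = solve-∀
  square : ∀ a i → suc a * (4 * (suc a + i)) + i + i * (3 + 4 * (a + i)) ≡ 4 * ((suc a + i) * (suc a + i))
  square = solve-∀
  rn : suc a * (4 * (suc a + i)) + i ≤ suc b + i
  rn = ≤-trans (slack _ (square a i)) (4r²≤n r-n)

C-diagonal-power : ∀ {r n} → Large r n → ∀ k → 3 + k ≤ r →
  (4 * r) ^ k * ((n ∸ (3 + k)) C (r ∸ (3 + k))) ≤ triples n r
C-diagonal-power r-n zero _ = ≤-reflexive (*-identityˡ _)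
C-diagonal-power {r} {n} r-n (suc k) k<r = begin
  4 * r * (4 * r) ^ k * b′      ≡⟨ shuffle (4 * r) ((4 * r) ^ k) b′ ⟩
  (4 * r) ^ k * (4 * r * b′)    ≤⟨ *-monoʳ-≤ ((4 * r) ^ k) (C-diagonal-decay r-n (3 + k) k<r) ⟩
  (4 * r) ^ k * ((n ∸ (3 + k)) C (r ∸ (3 + k)))  ≤⟨ C-diagonal-power r-n k (<⇒≤ k<r) ⟩
  triples n r                   ∎
  where
  open ≤-Reasoning
  b′ = (n ∸ (4 + k)) C (r ∸ (4 + k))
  shuffle : ∀ x y z → x * y * z ≡ y * (x * z)
  shuffle = solve-∀

^-distribʳ-* : ∀ k m n → (m * n) ^ k ≡ m ^ k * n ^ k
^-distribʳ-* zero m n = refl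
^-distribʳ-* (suc k) m n =
  trans (cong (m * n *_) (^-distribʳ-* k m n)) ([m*n]*[o*p]≡[m*o]*[n*p] m n (m ^ k) (n ^ k))

square≤6*4^ : ∀ k → (4 + k) * (4 + k) ≤ 6 * 4 ^ suc k
square≤6*4^ zero = m≤m+n 16 8
square≤6*4^ (suc k) = begin
  (5 + k) * (5 + k)         ≤⟨ slack _ (poly k) ⟩
  4 * ((4 + k) * (4 + k))   ≤⟨ *-monoʳ-≤ 4 (square≤6*4^ k) ⟩
  4 * (6 * 4 ^ suc k)       ≡⟨ swap (4 ^ suc k) ⟩
  6 * 4 ^ suc (suc k)       ∎
  where
  open ≤-Reasoning
  poly : ∀ k → (5 + k) * (5 + k) + (39 + 22 * k + 3 * (k * k)) ≡ 4 * ((4 + k) * (4 + k))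
  poly = solve-∀
  swap : ∀ x → 4 * (6 * x) ≡ 6 * (4 * x)
  swap = solve-∀

-- For `ρ ≤ 3` the claim is at most 9 ≤ 3 r. For `ρ` = 4 + k the binomial is at most `N` divided by
-- the (k + 1)-st power of 4 r, so the hypothesis forces `2 * 4 ^ suc k < r`, and `ρ * ρ` is at most
-- three times the left side.
cover-size : ∀ {r n} → Large r n → ∀ ρ → ρ ≤ r →
  2 * (r * (r * triples n r)) < r ^ ρ * ((n ∸ ρ) C (r ∸ ρ)) → ρ * ρ ≤ 3 * r
cover-size r-n 0 _ _ = z≤n
cover-size r-n 1 _ _ = ≤-trans (m≤m+n 1 8) (*-monoʳ-≤ 3 (3≤r r-n))
cover-size r-n 2 _ _ = ≤-trans (m≤m+n 4 5) (*-monoʳ-≤ 3 (3≤r r-n))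
cover-size r-n 3 _ _ = *-monoʳ-≤ 3 (3≤r r-n)
cover-size {r} {n} r-n (suc (suc (suc (suc k)))) ρ≤r large< = begin
  (4 + k) * (4 + k)       ≤⟨ square≤6*4^ k ⟩
  6 * 4 ^ suc k           ≡⟨ *-assoc 3 2 (4 ^ suc k) ⟩
  3 * (2 * 4 ^ suc k)     ≤⟨ *-monoʳ-≤ 3 (<⇒≤ 2*4^<r) ⟩
  3 * r                   ∎
  where
  open ≤-Reasoning
  N = triples n r
  p = 4 ^ suc k
  b = (n ∸ (4 + k)) C (r ∸ (4 + k))
  shuffle₁ : ∀ p x N → 2 * p * (x * (x * N)) ≡ 2 * (x * (x * N)) * p
  shuffle₁ = solve-∀
  shuffle₂ : ∀ x y b p → x * (x * (x * y)) * b * p ≡ x * (x * (x * (p * y * b)))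
  shuffle₂ = solve-∀
  instance
    p≢0 : NonZero p
    p≢0 = m^n≢0 4 (suc k)
  2*4^<r : 2 * p < r
  2*4^<r = *-cancelʳ-< (r * (r * N)) (2 * p) r (begin-strict
    2 * p * (r * (r * N))                ≡⟨ shuffle₁ p r N ⟩
    2 * (r * (r * N)) * p                <⟨ *-monoˡ-< p large< ⟩
    r ^ (4 + k) * b * p                  ≡⟨ shuffle₂ r (r ^ suc k) b p ⟩
    r * (r * (r * (p * r ^ suc k * b)))  ≡⟨ cong (λ z → r * (r * (r * (z * b)))) (^-distribʳ-* (suc k) 4 r) ⟨
    r * (r * (r * ((4 * r) ^ suc k * b)))
      ≤⟨ *-monoʳ-≤ r (*-monoʳ-≤ r (*-monoʳ-≤ r (C-diagonal-power r-n (suc k) ρ≤r))) ⟩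
    r * (r * (r * N))                    ∎)

-- Sums over subsets and lists of subsets

private variable
  n r : ℕ

+-interchange : ∀ a b c d → (a + b) + (c + d) ≡ (a + c) + (b + d)
+-interchange = solve-∀

bit : Bool → ℕ
bit true  = 1
bit false = 0

bit≤1 : ∀ b → bit b ≤ 1
bit≤1 true  = ≤-refl
bit≤1 false = z≤n

ind : Subset n → Fin n → ℕ
ind p x = bit (lookup p x)

ind-∈ : ∀ {p : Subset n} {x} → x ∈ p → ind p x ≡ 1
ind-∈ x∈p = cong bit ([]=⇒lookup x∈p)

ind-∉ : ∀ {p : Subset n} {x} → x ∉ p → ind p x ≡ 0
ind-∉ {p = p} {x} x∉p with lookup p x in eq
... | true  = contradiction (lookup⇒[]= x p eq) x∉p
... | false = refl

sumOn : Subset n → (Fin n → ℕ) → ℕ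
sumOn []      g = 0
sumOn (s ∷ p) g = bit s * g zero + sumOn p (g ∘ suc)

sumOn-mono : ∀ (p : Subset n) {g h} → (∀ {x} → x ∈ p → g x ≤ h x) → sumOn p g ≤ sumOn p h
sumOn-mono []          _ = z≤n
sumOn-mono (true ∷ p)  f = +-mono-≤ (*-monoʳ-≤ 1 (f here)) (sumOn-mono p (f ∘ there))
sumOn-mono (false ∷ p) f = sumOn-mono p (f ∘ there)

sumOn-cong : ∀ (p : Subset n) {g h} → (∀ x → g x ≡ h x) → sumOn p g ≡ sumOn p h
sumOn-cong []      _ = refl
sumOn-cong (s ∷ p) f = cong₂ (λ a b → bit s * a + b) (f zero) (sumOn-cong p (f ∘ suc))

sumOn-const : ∀ (p : Subset n) k → sumOn p (const k) ≡ ∣ p ∣ * k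
sumOn-const []          k = refl
sumOn-const (true ∷ p)  k = cong₂ _+_ (*-identityˡ k) (sumOn-const p k)
sumOn-const (false ∷ p) k = sumOn-const p k

sumOn-bound : ∀ (p : Subset n) {g k} → (∀ {x} → x ∈ p → g x ≤ k) → sumOn p g ≤ ∣ p ∣ * k
sumOn-bound p f = ≤-trans (sumOn-mono p f) (≤-reflexive (sumOn-const p _))

sumOn-+ : ∀ (p : Subset n) g h → sumOn p (λ x → g x + h x) ≡ sumOn p g + sumOn p h
sumOn-+ []      g h = refl
sumOn-+ (s ∷ p) g h =
  trans (cong₂ _+_ (*-distribˡ-+ (bit s) (g zero) (h zero)) (sumOn-+ p (g ∘ suc) (h ∘ suc)))
        (+-interchange (bit s * g zero) _ _ _)

sumOn-∈ : ∀ {p : Subset n} {x} g → x ∈ p → g x ≤ sumOn p g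
sumOn-∈ g here = ≤-trans (≤-reflexive (sym (*-identityˡ (g zero)))) (m≤m+n _ _)
sumOn-∈ g (there x∈p) = ≤-trans (sumOn-∈ (g ∘ suc) x∈p) (m≤n+m _ _)

sumOn-∈₂ : ∀ {p : Subset n} {x y} g → x ∈ p → y ∈ p → x ≢ y → g x + g y ≤ sumOn p g
sumOn-∈₂ g here here x≢y = contradiction refl x≢y
sumOn-∈₂ g here (there y∈p) _ =
  +-mono-≤ (≤-reflexive (sym (*-identityˡ (g zero)))) (sumOn-∈ (g ∘ suc) y∈p)
sumOn-∈₂ g (there x∈p) here _ = ≤-trans (≤-reflexive (+-comm _ (g zero)))
  (+-mono-≤ (≤-reflexive (sym (*-identityˡ (g zero)))) (sumOn-∈ (g ∘ suc) x∈p))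
sumOn-∈₂ g (there x∈p) (there y∈p) x≢y =
  ≤-trans (sumOn-∈₂ (g ∘ suc) x∈p y∈p (x≢y ∘ cong suc)) (m≤n+m _ _)

-- The exceptional point `b` is counted under `m` and again in `∣ p ∣ * k`, which keeps predecessors
-- out of the bound.
sumOn-except : ∀ (p : Subset n) {g k m} b → (∀ {x} → x ∈ p → x ≢ b → g x ≤ k) → g b ≤ m →
  sumOn p g ≤ m + ∣ p ∣ * k
sumOn-except (true ∷ p) {g} {k} {m} zero f gb≤m = begin
  1 * g zero + sumOn p (g ∘ suc)
    ≤⟨ +-mono-≤ (≤-trans (≤-reflexive (*-identityˡ (g zero))) gb≤m) (sumOn-bound p (λ x∈p → f (there x∈p) λ ())) ⟩
  m + ∣ p ∣ * k          ≤⟨ +-monoʳ-≤ m (m≤n+m _ k) ⟩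
  m + (k + ∣ p ∣ * k)    ∎
  where open ≤-Reasoning
sumOn-except (false ∷ p) {m = m} zero f _ =
  ≤-trans (sumOn-bound p (λ x∈p → f (there x∈p) λ ())) (m≤n+m _ m)
sumOn-except (true ∷ p) {g} {k} {m} (suc b) f gb≤m = begin
  1 * g zero + sumOn p (g ∘ suc)
    ≤⟨ +-mono-≤ (≤-trans (≤-reflexive (*-identityˡ (g zero))) (f here λ ()))
                (sumOn-except p b (λ x∈p x≢b → f (there x∈p) λ { refl → x≢b refl }) gb≤m) ⟩
  k + (m + ∣ p ∣ * k)    ≡⟨ swap k m _ ⟩
  m + (k + ∣ p ∣ * k)    ∎
  where
  open ≤-Reasoning
  swap : ∀ a b c → a + (b + c) ≡ b + (a + c)
  swap = solve-∀
sumOn-except (false ∷ p) (suc b) f gb≤m =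
  sumOn-except p b (λ x∈p x≢b → f (there x∈p) λ { refl → x≢b refl }) gb≤m

argmax : ∀ (p : Subset n) (g : Fin n → ℕ) → Nonempty p → ∃ λ a → a ∈ p × (∀ {x} → x ∈ p → g x ≤ g a)
argmax (false ∷ p) g (suc x , there x∈p) with argmax p (g ∘ suc) (x , x∈p)
... | a , a∈p , max = suc a , there a∈p , λ { (there y∈p) → max y∈p }
argmax (true ∷ p) g _ with nonempty? p
... | no empty = zero , here , λ { here → ≤-refl ; (there y∈p) → contradiction (_ , y∈p) empty }
... | yes ne with argmax p (g ∘ suc) ne
...   | a , a∈p , max with g zero ≤? g (suc a)
...     | yes g0≤ga = suc a , there a∈p , λ { here → g0≤ga ; (there y∈p) → max y∈p }
...     | no g0≰ga = zero , here , λ { here → ≤-refl ; (there y∈p) → ≤-trans (max y∈p) (≰⇒≥ g0≰ga) }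

∣e∣-split : ∀ (p e : Subset n) → sumOn p (ind e) + sumOn (∁ p) (ind e) ≡ ∣ e ∣
∣e∣-split [] [] = refl
∣e∣-split (true ∷ p)  (true ∷ e)  = cong suc (∣e∣-split p e)
∣e∣-split (true ∷ p)  (false ∷ e) = ∣e∣-split p e
∣e∣-split (false ∷ p) (true ∷ e)  =
  trans (+-suc (sumOn p (ind e)) _) (cong suc (∣e∣-split p e))
∣e∣-split (false ∷ p) (false ∷ e) = ∣e∣-split p e

-- The left side is the contribution of an edge `e` to the degree sum over the complement of `p`.
outside-one : ∀ {p e : Subset n} {x} → x ∈ p → x ∈ e → sumOn (∁ p) (ind e) ≤ ∣ e ∣ ∸ 1
outside-one {p = p} {e} x∈p x∈e =
  m+n≤o⇒m≤o∸n _ (subst₂ _≤_ (+-comm 1 _) (∣e∣-split p e)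
    (+-monoˡ-≤ _ (subst (_≤ sumOn p (ind e)) (ind-∈ x∈e) (sumOn-∈ (ind e) x∈p))))

outside-two : ∀ {p e : Subset n} {x y} → x ∈ p → x ∈ e → y ∈ p → y ∈ e → x ≢ y →
  sumOn (∁ p) (ind e) ≤ ∣ e ∣ ∸ 2
outside-two {p = p} {e} x∈p x∈e y∈p y∈e x≢y =
  m+n≤o⇒m≤o∸n _ (subst₂ _≤_ (+-comm 2 _) (∣e∣-split p e)
    (+-monoˡ-≤ _ (subst (_≤ sumOn p (ind e)) (cong₂ _+_ (ind-∈ x∈e) (ind-∈ y∈e))
      (sumOn-∈₂ (ind e) x∈p y∈p x≢y))))

-- Unions, insertion and deletion of points

∣p∪q∣≤∣p∣+∣q∣ : ∀ (p q : Subset n) → ∣ p ∪ q ∣ ≤ ∣ p ∣ + ∣ q ∣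
∣p∪q∣≤∣p∣+∣q∣ [] [] = z≤n
∣p∪q∣≤∣p∣+∣q∣ (true ∷ p)  (true ∷ q)  = s≤s (≤-trans (∣p∪q∣≤∣p∣+∣q∣ p q) (+-monoʳ-≤ ∣ p ∣ (n≤1+n _)))
∣p∪q∣≤∣p∣+∣q∣ (true ∷ p)  (false ∷ q) = s≤s (∣p∪q∣≤∣p∣+∣q∣ p q)
∣p∪q∣≤∣p∣+∣q∣ (false ∷ p) (true ∷ q)  = ≤-trans (s≤s (∣p∪q∣≤∣p∣+∣q∣ p q)) (≤-reflexive (sym (+-suc ∣ p ∣ _)))
∣p∪q∣≤∣p∣+∣q∣ (false ∷ p) (false ∷ q) = ∣p∪q∣≤∣p∣+∣q∣ p q

infixl 6 _⊕_

_⊕_ : Subset n → Fin n → Subset n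
p ⊕ x = p [ x ]≔ inside

x∈p⊕x : ∀ (p : Subset n) x → x ∈ p ⊕ x
x∈p⊕x (_ ∷ p) zero    = here
x∈p⊕x (_ ∷ p) (suc x) = there (x∈p⊕x p x)

p⊆p⊕x : ∀ (p : Subset n) x → p ⊆ p ⊕ x
p⊆p⊕x (_ ∷ p) zero    here        = here
p⊆p⊕x (_ ∷ p) zero    (there y∈p) = there y∈p
p⊆p⊕x (_ ∷ p) (suc x) here        = here
p⊆p⊕x (_ ∷ p) (suc x) (there y∈p) = there (p⊆p⊕x p x y∈p)

∈⊕⁻ : ∀ (p : Subset n) x {y} → y ∈ p ⊕ x → y ≡ x ⊎ y ∈ p
∈⊕⁻ (_ ∷ p) zero    here        = inj₁ refl
∈⊕⁻ (_ ∷ p) zero    (there y∈p) = inj₂ (there y∈p)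
∈⊕⁻ (_ ∷ p) (suc x) here        = inj₂ here
∈⊕⁻ (_ ∷ p) (suc x) (there y∈)  with ∈⊕⁻ p x y∈
... | inj₁ refl = inj₁ refl
... | inj₂ y∈p  = inj₂ (there y∈p)

∉⊕ : ∀ {p : Subset n} {x y} → y ≢ x → y ∉ p → y ∉ p ⊕ x
∉⊕ {p = p} {x} y≢x y∉p y∈ = [ y≢x , y∉p ]′ (∈⊕⁻ p x y∈)

∣p⊕x∣≡1+∣p∣ : ∀ {p : Subset n} {x} → x ∉ p → ∣ p ⊕ x ∣ ≡ suc ∣ p ∣
∣p⊕x∣≡1+∣p∣ {p = true ∷ p}  {zero}  x∉p = contradiction here x∉p
∣p⊕x∣≡1+∣p∣ {p = false ∷ p} {zero}  x∉p = refl
∣p⊕x∣≡1+∣p∣ {p = true ∷ p}  {suc x} x∉p = cong suc (∣p⊕x∣≡1+∣p∣ (x∉p ∘ there))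
∣p⊕x∣≡1+∣p∣ {p = false ∷ p} {suc x} x∉p = ∣p⊕x∣≡1+∣p∣ (x∉p ∘ there)

∣p⊕x∣≤1+∣p∣ : ∀ (p : Subset n) x → ∣ p ⊕ x ∣ ≤ suc ∣ p ∣
∣p⊕x∣≤1+∣p∣ (true ∷ p)  zero    = n≤1+n _
∣p⊕x∣≤1+∣p∣ (false ∷ p) zero    = ≤-refl
∣p⊕x∣≤1+∣p∣ (true ∷ p)  (suc x) = s≤s (∣p⊕x∣≤1+∣p∣ p x)
∣p⊕x∣≤1+∣p∣ (false ∷ p) (suc x) = ∣p⊕x∣≤1+∣p∣ p x

infixl 6 _⊖_

_⊖_ : Subset n → Fin n → Subset n
p ⊖ x = p [ x ]≔ outside

p⊖x⊆p : ∀ (p : Subset n) x → p ⊖ x ⊆ p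
p⊖x⊆p (_ ∷ p) zero    (there y∈) = there y∈
p⊖x⊆p (_ ∷ p) (suc x) here       = here
p⊖x⊆p (_ ∷ p) (suc x) (there y∈) = there (p⊖x⊆p p x y∈)

∣p∣≡1+∣p⊖x∣ : ∀ {p : Subset n} {x} → x ∈ p → ∣ p ∣ ≡ suc ∣ p ⊖ x ∣
∣p∣≡1+∣p⊖x∣ here = refl
∣p∣≡1+∣p⊖x∣ {p = true ∷ p}  (there x∈p) = cong suc (∣p∣≡1+∣p⊖x∣ x∈p)
∣p∣≡1+∣p⊖x∣ {p = false ∷ p} (there x∈p) = ∣p∣≡1+∣p⊖x∣ x∈p

sumOn-⊖ : ∀ {p : Subset n} {x} g → x ∈ p → sumOn p g ≡ g x + sumOn (p ⊖ x) g
sumOn-⊖ {p = _ ∷ p} g here = cong (_+ sumOn p (g ∘ suc)) (*-identityˡ (g zero))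
sumOn-⊖ {p = s ∷ p} {suc x} g (there x∈p) =
  trans (cong (bit s * g zero +_) (sumOn-⊖ (g ∘ suc) x∈p)) (swap (bit s * g zero) (g (suc x)) _)
  where
  swap : ∀ a b c → a + (b + c) ≡ b + (a + c)
  swap = solve-∀

∣p∣>0⇒Nonempty : ∀ (p : Subset n) → 0 < ∣ p ∣ → Nonempty p
∣p∣>0⇒Nonempty (true ∷ p)  _ = zero , here
∣p∣>0⇒Nonempty (false ∷ p) 0<∣p∣ with ∣p∣>0⇒Nonempty p 0<∣p∣
... | x , x∈p = suc x , there x∈p

-- Discarding the vertices of largest weight never raises the average.
select : ∀ k (p : Subset n) {g r d} → ∣ p ∣ ≡ k + r → sumOn p g ≤ ∣ p ∣ * d →
  ∃ λ q → q ⊆ p × ∣ q ∣ ≡ r × sumOn q g ≤ r * d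
select zero p {g} {r} {d} ∣p∣≡r avg = p , (λ x∈p → x∈p) , ∣p∣≡r , subst (λ s → sumOn p g ≤ s * d) ∣p∣≡r avg
select (suc k) p {g} {r} {d} ∣p∣≡ avg
  with argmax p g (∣p∣>0⇒Nonempty p (subst (0 <_) (sym ∣p∣≡) (s≤s z≤n)))
... | a , a∈p , max with select k (p ⊖ a) {g} {r} {d} ∣p⊖a∣ avg′
  where
  ∣p⊖a∣ : ∣ p ⊖ a ∣ ≡ k + r
  ∣p⊖a∣ = suc-injective (trans (sym (∣p∣≡1+∣p⊖x∣ a∈p)) ∣p∣≡)
  avg′ : sumOn (p ⊖ a) g ≤ ∣ p ⊖ a ∣ * d
  -- If the largest weight is at least `d`, removing it takes at least `d` off the sum; otherwise
  -- every weight is at most `d`.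
  avg′ with d ≤? g a
  ... | yes d≤ga = +-cancelˡ-≤ d _ _ (begin
    d + sumOn (p ⊖ a) g     ≤⟨ +-monoˡ-≤ _ d≤ga ⟩
    g a + sumOn (p ⊖ a) g   ≡⟨ sumOn-⊖ g a∈p ⟨
    sumOn p g               ≤⟨ avg ⟩
    ∣ p ∣ * d               ≡⟨ cong (_* d) (∣p∣≡1+∣p⊖x∣ a∈p) ⟩
    d + ∣ p ⊖ a ∣ * d       ∎)
    where open ≤-Reasoning
  ... | no d≰ga = sumOn-bound (p ⊖ a) (λ x∈ → ≤-trans (max (p⊖x⊆p p a x∈)) (≰⇒≥ d≰ga))
... | q , q⊆ , ∣q∣≡r , sum≤ = q , (λ x∈q → p⊖x⊆p p a (q⊆ x∈q)) , ∣q∣≡r , sum≤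

-- Sums over lists and double counting

sumL : ∀ {A : Set} → List A → (A → ℕ) → ℕ
sumL []       w = 0
sumL (e ∷ es) w = w e + sumL es w

sumL-mono : ∀ {A : Set} (es : List A) {v w} → (∀ {e} → e LM.∈ es → v e ≤ w e) → sumL es v ≤ sumL es w
sumL-mono []       _ = z≤n
sumL-mono (e ∷ es) f = +-mono-≤ (f (here refl)) (sumL-mono es (f ∘ there))

sumL-cong : ∀ {A : Set} (es : List A) {v w} → (∀ e → v e ≡ w e) → sumL es v ≡ sumL es w
sumL-cong []       _ = refl
sumL-cong (e ∷ es) f = cong₂ _+_ (f e) (sumL-cong es f)

sumL-+ : ∀ {A : Set} (es : List A) v w → sumL es (λ e → v e + w e) ≡ sumL es v + sumL es w
sumL-+ []       v w = refl
sumL-+ (e ∷ es) v w = trans (cong (v e + w e +_) (sumL-+ es v w)) (+-interchange (v e) _ _ _)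

sumL-* : ∀ {A : Set} (es : List A) c w → sumL es (λ e → c * w e) ≡ c * sumL es w
sumL-* []       c w = sym (*-zeroʳ c)
sumL-* (e ∷ es) c w = trans (cong (c * w e +_) (sumL-* es c w)) (sym (*-distribˡ-+ c (w e) _))

sumL-sumOn : ∀ {A : Set} (es : List A) (p : Subset n) (h : A → Fin n → ℕ) →
  sumL es (λ e → sumOn p (h e)) ≡ sumOn p (λ x → sumL es (λ e → h e x))
sumL-sumOn []       p h = sym (trans (sumOn-const p 0) (*-zeroʳ ∣ p ∣))
sumL-sumOn (e ∷ es) p h =
  trans (cong (sumOn p (h e) +_) (sumL-sumOn es p h)) (sym (sumOn-+ p (h e) _))

sumL-witness : ∀ {A : Set} (es : List A) w → 0 < sumL es w → ∃ λ e → e LM.∈ es × 0 < w e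
sumL-witness (e ∷ es) w 0<sum with w e in eq
... | suc _ = e , here refl , subst (0 <_) (sym eq) (s≤s z≤n)
... | zero with sumL-witness es w 0<sum
...   | e′ , e′∈ , 0<w = e′ , there e′∈ , 0<w

length-filter-∈ : ∀ v (es : List (Subset n)) → length (filter (v ∈?_) es) ≡ sumL es (λ e → ind e v)
length-filter-∈ v [] = refl
length-filter-∈ v (e ∷ es) with v ∈? e
... | yes v∈e = cong₂ _+_ (sym (ind-∈ v∈e)) (length-filter-∈ v es)
... | no  v∉e = cong₂ _+_ (sym (ind-∉ v∉e)) (length-filter-∈ v es)

-- The indicator of `p ⊆ e`, as a number so that it can be multiplied by weights and summed over
-- edges.
sub : Subset n → Subset n → ℕ
sub []          []      = 1
sub (true ∷ p)  (t ∷ e) = bit t * sub p e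
sub (false ∷ p) (t ∷ e) = sub p e

sub-⊥ : ∀ (e : Subset n) → sub ⊥ e ≡ 1
sub-⊥ []      = refl
sub-⊥ (_ ∷ e) = sub-⊥ e

sub-⊕ : ∀ (p : Subset n) x e → sub (p ⊕ x) e ≡ sub p e * ind e x
sub-⊕ (true ∷ p)  zero    (true ∷ e)  = sym (*-identityʳ _)
sub-⊕ (true ∷ p)  zero    (false ∷ e) = refl
sub-⊕ (false ∷ p) zero    (t ∷ e)     = *-comm (bit t) _
sub-⊕ (true ∷ p)  (suc x) (t ∷ e)     =
  trans (cong (bit t *_) (sub-⊕ p x e)) (sym (*-assoc (bit t) (sub p e) _))
sub-⊕ (false ∷ p) (suc x) (t ∷ e)     = sub-⊕ p x e

sub-⊕-∈ : ∀ (p : Subset n) {x e} → x ∈ e → sub (p ⊕ x) e ≡ sub p e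
sub-⊕-∈ p {x} {e} x∈e =
  trans (sub-⊕ p x e) (trans (cong (sub p e *_) (ind-∈ x∈e)) (*-identityʳ _))

sub-⊕-∉ : ∀ (p : Subset n) {x e} → x ∉ e → sub (p ⊕ x) e ≡ 0
sub-⊕-∉ p {x} {e} x∉e =
  trans (sub-⊕ p x e) (trans (cong (sub p e *_) (ind-∉ x∉e)) (*-zeroʳ (sub p e)))

sub-⁅⁆ : ∀ (x : Fin n) e → sub (⊥ ⊕ x) e ≡ ind e x
sub-⁅⁆ x e = trans (sub-⊕ ⊥ x e) (trans (cong (_* ind e x) (sub-⊥ e)) (*-identityˡ _))

sub≤1 : ∀ (p e : Subset n) → sub p e ≤ 1
sub≤1 []          []      = ≤-refl
sub≤1 (true ∷ p)  (t ∷ e) = *-mono-≤ (bit≤1 t) (sub≤1 p e)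
sub≤1 (false ∷ p) (t ∷ e) = sub≤1 p e

sub>0⇒⊆ : ∀ (p e : Subset n) → 0 < sub p e → p ⊆ e
sub>0⇒⊆ (true ∷ p)  (true ∷ e) _  here        = here
sub>0⇒⊆ (true ∷ p)  (true ∷ e) s (there x∈p) = there (sub>0⇒⊆ p e (subst (0 <_) (*-identityˡ _) s) x∈p)
sub>0⇒⊆ (false ∷ p) (t ∷ e)    s (there x∈p) = there (sub>0⇒⊆ p e s x∈p)

sub-∌ : ∀ {p e : Subset n} {x} → x ∈ p → x ∉ e → sub p e ≡ 0
sub-∌ {p = p} {e} x∈p x∉e with sub p e in eq
... | zero  = refl
... | suc _ = contradiction (sub>0⇒⊆ p e (subst (0 <_) (sym eq) (s≤s z≤n)) x∈p) x∉e

-- The indicator of `∣ e ∣ ≡ k`, by recursion on `e` so that counting can proceed point by point.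
sized : ℕ → Subset n → ℕ
sized zero    []          = 1
sized (suc k) []          = 0
sized k       (false ∷ e) = sized k e
sized zero    (true ∷ e)  = 0
sized (suc k) (true ∷ e)  = sized k e

sized-∣∣ : ∀ (e : Subset n) → sized ∣ e ∣ e ≡ 1
sized-∣∣ []          = refl
sized-∣∣ (true ∷ e)  = sized-∣∣ e
sized-∣∣ (false ∷ e) = trans (sized-false ∣ e ∣ e) (sized-∣∣ e)
  where
  sized-false : ∀ k (e : Subset n) → sized k (false ∷ e) ≡ sized k e
  sized-false zero    e = refl
  sized-false (suc k) e = refl

-- Sums over all subsets and counts of r-sets with prescribed points

sumAll : ∀ n → (Subset n → ℕ) → ℕ
sumAll zero    w = w []
sumAll (suc n) w = sumAll n (w ∘ (true ∷_)) + sumAll n (w ∘ (false ∷_))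

sumAll-mono : ∀ n {v w} → (∀ e → v e ≤ w e) → sumAll n v ≤ sumAll n w
sumAll-mono zero    f = f []
sumAll-mono (suc n) f = +-mono-≤ (sumAll-mono n (f ∘ (true ∷_))) (sumAll-mono n (f ∘ (false ∷_)))

sumAll-cong : ∀ n {v w} → (∀ e → v e ≡ w e) → sumAll n v ≡ sumAll n w
sumAll-cong zero    f = f []
sumAll-cong (suc n) f = cong₂ _+_ (sumAll-cong n (f ∘ (true ∷_))) (sumAll-cong n (f ∘ (false ∷_)))

sumAll-+ : ∀ n v w → sumAll n (λ e → v e + w e) ≡ sumAll n v + sumAll n w
sumAll-+ zero    v w = refl
sumAll-+ (suc n) v w =
  trans (cong₂ _+_ (sumAll-+ n (v ∘ (true ∷_)) (w ∘ (true ∷_))) (sumAll-+ n (v ∘ (false ∷_)) (w ∘ (false ∷_))))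
        (+-interchange (sumAll n (v ∘ (true ∷_))) _ _ _)

sumAll-0 : ∀ n {w} → (∀ e → w e ≡ 0) → sumAll n w ≡ 0
sumAll-0 zero    f = f []
sumAll-0 (suc n) f = cong₂ _+_ (sumAll-0 n (f ∘ (true ∷_))) (sumAll-0 n (f ∘ (false ∷_)))

sumAll-remove : ∀ {n} (e : Subset n) {v w} → v e ≡ 0 → (∀ e′ → v e′ ≤ w e′) → w e + sumAll n v ≤ sumAll n w
sumAll-remove [] {v} {w} v[]≡0 _ = ≤-reflexive (trans (cong (w [] +_) v[]≡0) (+-identityʳ _))
sumAll-remove (true ∷ e) {v} {w} ve≡0 v≤w = ≤-trans (≤-reflexive (sym (+-assoc (w (true ∷ e)) _ _)))
  (+-mono-≤ (sumAll-remove e ve≡0 (v≤w ∘ (true ∷_))) (sumAll-mono _ (v≤w ∘ (false ∷_))))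
sumAll-remove (false ∷ e) {v} {w} ve≡0 v≤w = ≤-trans (≤-reflexive (swap (w (false ∷ e)) (sumAll _ (v ∘ (true ∷_))) _))
  (+-mono-≤ (sumAll-mono _ (v≤w ∘ (true ∷_))) (sumAll-remove e ve≡0 (v≤w ∘ (false ∷_))))
  where
  swap : ∀ a b c → a + (b + c) ≡ b + (a + c)
  swap = solve-∀

erase : Subset n → (Subset n → ℕ) → Subset n → ℕ
erase e w e′ with ≡-dec Bool._≟_ e e′
... | yes _ = 0
... | no _  = w e′

erase-≡ : ∀ (e : Subset n) w → erase e w e ≡ 0
erase-≡ e w with ≡-dec Bool._≟_ e e
... | yes _  = refl
... | no e≢e = contradiction refl e≢e

erase-≢ : ∀ {e e′ : Subset n} w → e ≢ e′ → erase e w e′ ≡ w e′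
erase-≢ {e = e} {e′} w e≢e′ with ≡-dec Bool._≟_ e e′
... | yes e≡e′ = contradiction e≡e′ e≢e′
... | no _     = refl

erase-≤ : ∀ (e : Subset n) w e′ → erase e w e′ ≤ w e′
erase-≤ e w e′ with ≡-dec Bool._≟_ e e′
... | yes _ = z≤n
... | no _  = ≤-refl

-- The weight of the head is erased before the tail is compared; since the list has no repetitions,
-- the tail does not notice.
sumL≤sumAll : ∀ {es : List (Subset n)} → Unique es → ∀ w → sumL es w ≤ sumAll n w
sumL≤sumAll [] w = z≤n
sumL≤sumAll {n} {e ∷ es} (e∉es ∷ es!) w = begin
  w e + sumL es w             ≤⟨ +-monoʳ-≤ (w e) (sumL-mono es λ e′∈es →
                                   ≤-reflexive (sym (erase-≢ w (All.lookup e∉es e′∈es)))) ⟩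
  w e + sumL es (erase e w)   ≤⟨ +-monoʳ-≤ (w e) (sumL≤sumAll es! (erase e w)) ⟩
  w e + sumAll n (erase e w)  ≤⟨ sumAll-remove e (erase-≡ e w) (erase-≤ e w) ⟩
  sumAll n w                  ∎
  where open ≤-Reasoning

-- `sumL≤sumAll` for the weight `w ∸ v`. In use, `w` marks all r-sets through some points and `v`
-- marks non-edges among them.
sumL+sumAll≤sumAll : ∀ {es : List (Subset n)} → Unique es → ∀ {u v w} →
  (∀ {e} → e LM.∈ es → u e + v e ≤ w e) → (∀ e → v e ≤ w e) → sumL es u + sumAll n v ≤ sumAll n w
sumL+sumAll≤sumAll {n} {es} es! {u} {v} {w} u+v≤w v≤w = begin
  sumL es u + sumAll n v
    ≤⟨ +-monoˡ-≤ _ (sumL-mono es λ e∈es → m+n≤o⇒m≤o∸n (u _) (u+v≤w e∈es)) ⟩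
  sumL es (λ e → w e ∸ v e) + sumAll n v
    ≤⟨ +-monoˡ-≤ _ (sumL≤sumAll es! (λ e → w e ∸ v e)) ⟩
  sumAll n (λ e → w e ∸ v e) + sumAll n v
    ≡⟨ sumAll-+ n (λ e → w e ∸ v e) v ⟨
  sumAll n (λ e → (w e ∸ v e) + v e)
    ≡⟨ sumAll-cong n (λ e → m∸n+n≡m (v≤w e)) ⟩
  sumAll n w ∎
  where open ≤-Reasoning

-- The indicator of the `k`-sets that contain `R` and are disjoint from `X`.
fits : Subset n → Subset n → ℕ → Subset n → ℕ
fits R X k e = sub R e * sub X (∁ e) * sized k e

free : Subset n → Subset n → ℕ
free []          []          = 0
free (true ∷ R)  (_ ∷ X)     = free R X
free (false ∷ R) (true ∷ X)  = free R X
free (false ∷ R) (false ∷ X) = suc (free R X)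

∣R∣+∣X∣+free : ∀ {R X : Subset n} → (∀ {x} → x ∈ R → x ∉ X) → ∣ R ∣ + ∣ X ∣ + free R X ≡ n
∣R∣+∣X∣+free {R = []}        {[]}        _ = refl
∣R∣+∣X∣+free {R = true ∷ R}  {true ∷ X}  d = contradiction here (d here)
∣R∣+∣X∣+free {R = true ∷ R}  {false ∷ X} d = cong suc (∣R∣+∣X∣+free (λ x∈R x∈X → d (there x∈R) (there x∈X)))
∣R∣+∣X∣+free {R = false ∷ R} {true ∷ X}  d =
  trans (cong (_+ free R X) (+-suc ∣ R ∣ ∣ X ∣)) (cong suc (∣R∣+∣X∣+free (λ x∈R x∈X → d (there x∈R) (there x∈X))))
∣R∣+∣X∣+free {R = false ∷ R} {false ∷ X} d =
  trans (+-suc _ (free R X)) (cong suc (∣R∣+∣X∣+free (λ x∈R x∈X → d (there x∈R) (there x∈X))))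

-- f C (k ∸ i), except that it vanishes for k < i
through : ℕ → ℕ → ℕ → ℕ
through zero    f k       = f C k
through (suc i) f zero    = 0
through (suc i) f (suc k) = through i f k

through-≤ : ∀ {i k} f → i ≤ k → through i f k ≡ f C (k ∸ i)
through-≤ f z≤n       = refl
through-≤ f (s≤s i≤k) = through-≤ f i≤k

through-0 : ∀ i f → through i f 0 ≡ through i (suc f) 0
through-0 zero    f = trans (nC0≡1 f) (sym (nC0≡1 (suc f)))
through-0 (suc i) f = refl

through-pascal : ∀ i f k → through i f k + through i f (suc k) ≡ through i (suc f) (suc k)
through-pascal zero          f k       = nCk+nC[k+1]≡[n+1]C[k+1] f k
through-pascal (suc i)       f zero    = through-0 i f
through-pascal (suc i)       f (suc k) = through-pascal i f k

-- Point by point: a point of `R` lowers `k`, a point of `X` changes nothing, and any other point is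
-- an instance of Pascal's rule.
sumAll-fits : ∀ {R X : Subset n} k → (∀ {x} → x ∈ R → x ∉ X) →
  sumAll n (fits R X k) ≡ through ∣ R ∣ (free R X) k
sumAll-fits {R = []} {[]} zero    _ = refl
sumAll-fits {R = []} {[]} (suc k) _ = refl
sumAll-fits {R = true ∷ R} {true ∷ X} k d = contradiction here (d here)
sumAll-fits {suc n} {true ∷ R} {false ∷ X} zero d =
  cong₂ _+_ (sumAll-0 n (λ e → *-zeroʳ ((1 * sub R e) * sub X (∁ e)))) (sumAll-0 n (λ e → refl))
sumAll-fits {suc n} {true ∷ R} {false ∷ X} (suc k) d =
  trans (cong₂ _+_ (trans (sumAll-cong n (λ e → cong (λ z → z * sub X (∁ e) * sized k e) (*-identityˡ (sub R e))))
                          (sumAll-fits k (λ x∈R x∈X → d (there x∈R) (there x∈X))))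
                   (sumAll-0 n (λ e → refl)))
        (+-identityʳ _)
sumAll-fits {suc n} {false ∷ R} {true ∷ X} k d =
  cong₂ _+_ (sumAll-0 n (λ e → cong (_* sized k (true ∷ e)) (*-zeroʳ (sub R e))))
            (trans (sumAll-cong n (λ e → cong₂ (λ y z → sub R e * y * z) (*-identityˡ (sub X (∁ e))) (sized-out k e)))
                   (sumAll-fits k (λ x∈R x∈X → d (there x∈R) (there x∈X))))
  where
  sized-out : ∀ k (e : Subset n) → sized k (false ∷ e) ≡ sized k e
  sized-out zero    e = refl
  sized-out (suc k) e = refl
sumAll-fits {suc n} {false ∷ R} {false ∷ X} zero d =
  trans (cong₂ _+_ (sumAll-0 n (λ e → *-zeroʳ (sub R e * sub X (∁ e))))
                   (sumAll-fits zero (λ x∈R x∈X → d (there x∈R) (there x∈X))))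
        (through-0 ∣ R ∣ (free R X))
sumAll-fits {suc n} {false ∷ R} {false ∷ X} (suc k) d =
  trans (cong₂ _+_ (sumAll-fits k (λ x∈R x∈X → d (there x∈R) (there x∈X)))
                   (sumAll-fits (suc k) (λ x∈R x∈X → d (there x∈R) (there x∈X))))
        (through-pascal ∣ R ∣ (free R X) k)

sumAll-fits-C : ∀ {R X : Subset n} {k} → (∀ {x} → x ∈ R → x ∉ X) → ∣ R ∣ ≤ k →
  sumAll n (fits R X k) ≡ (n ∸ ∣ X ∣ ∸ ∣ R ∣) C (k ∸ ∣ R ∣)
sumAll-fits-C {n} {R} {X} {k} d ∣R∣≤k =
  trans (sumAll-fits k d) (trans (through-≤ (free R X) ∣R∣≤k) (cong (_C (k ∸ ∣ R ∣)) free≡))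
  where
  shuffle : ∀ a b c → a + b + c ≡ b + (a + c)
  shuffle = solve-∀
  free≡ : free R X ≡ n ∸ ∣ X ∣ ∸ ∣ R ∣
  free≡ = sym (trans (cong (λ m → m ∸ ∣ X ∣ ∸ ∣ R ∣) (trans (sym (∣R∣+∣X∣+free d)) (shuffle ∣ R ∣ ∣ X ∣ _)))
                     (trans (cong (_∸ ∣ R ∣) (m+n∸m≡n ∣ X ∣ _)) (m+n∸m≡n ∣ R ∣ _)))

fits-⊥ : ∀ (R : Subset n) k e → fits R ⊥ k e ≡ sub R e * sized k e
fits-⊥ R k e = cong (_* sized k e) (trans (cong (sub R e *_) (sub-⊥ (∁ e))) (*-identityʳ (sub R e)))

-- Intersecting hypergraphs

-- The local function by which degSet is defined cannot be named; unification recovers it.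
mutual
  degSet-go : ∀ {n r} → Hypergraph n r → Subset n → List (Fin n) → ℕ
  degSet-go = _

  degSet≡go : ∀ {n r} (H : Hypergraph n r) S → degSet H S ≡ degSet-go H S (allFin n)
  degSet≡go {n} H S with allFin n
  ... | vs = refl

-- Stated for an arbitrary `f`, because the tail of a tabulation is the tabulation of `f ∘ suc`.
degSet-go-tabulate : ∀ {m n r} (H : Hypergraph n r) S (p : Subset m) f →
  (∀ i → ind S (f i) ≡ ind p i) → degSet-go H S (tabulate f) ≡ sumOn p (deg H ∘ f)
degSet-go-tabulate H S []      f _ = refl
degSet-go-tabulate H S (s ∷ p) f S≡p with f zero ∈? S
... | yes v∈S = cong₂ _+_
  (sym (trans (cong (_* deg H (f zero)) (trans (sym (S≡p zero)) (ind-∈ v∈S))) (*-identityˡ _)))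
  (degSet-go-tabulate H S p (f ∘ suc) (S≡p ∘ suc))
... | no v∉S = cong₂ _+_
  (sym (cong (_* deg H (f zero)) (trans (sym (S≡p zero)) (ind-∉ v∉S))))
  (degSet-go-tabulate H S p (f ∘ suc) (S≡p ∘ suc))

degSet≡sumOn : ∀ (H : Hypergraph n r) S → degSet H S ≡ sumOn S (deg H)
degSet≡sumOn H S = trans (degSet≡go H S) (degSet-go-tabulate H S S (λ i → i) (λ _ → refl))

-- Built by insertion, so that singletons, pairs and triples are all handled by the lemmas on `_⊕_`.
⟪_⟫ : Fin n → Subset n
⟪ x ⟫ = ⊥ ⊕ x

⟪_&_⟫ : Fin n → Fin n → Subset n
⟪ x & y ⟫ = ⟪ x ⟫ ⊕ y

∉⟪⟫ : ∀ {x y : Fin n} → y ≢ x → y ∉ ⟪ x ⟫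
∉⟪⟫ y≢x = ∉⊕ y≢x ∉⊥

∉⟪&⟫ : ∀ {x y z : Fin n} → z ≢ x → z ≢ y → z ∉ ⟪ x & y ⟫
∉⟪&⟫ z≢x z≢y = ∉⊕ z≢y (∉⟪⟫ z≢x)

∣⟪⟫∣ : ∀ (x : Fin n) → ∣ ⟪ x ⟫ ∣ ≡ 1
∣⟪⟫∣ {n} x = trans (∣p⊕x∣≡1+∣p∣ {p = ⊥} {x} ∉⊥) (cong suc (∣⊥∣≡0 n))

∣⟪&⟫∣ : ∀ {x y : Fin n} → x ≢ y → ∣ ⟪ x & y ⟫ ∣ ≡ 2
∣⟪&⟫∣ {x = x} x≢y = trans (∣p⊕x∣≡1+∣p∣ {p = ⟪ x ⟫} (∉⟪⟫ (≢-sym x≢y))) (cong suc (∣⟪⟫∣ x))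

∣triple∣ : ∀ {x y z : Fin n} → x ≢ y → z ≢ x → z ≢ y → ∣ ⟪ x & y ⟫ ⊕ z ∣ ≡ 3
∣triple∣ {x = x} {y} x≢y z≢x z≢y = trans (∣p⊕x∣≡1+∣p∣ {p = ⟪ x & y ⟫} (∉⟪&⟫ z≢x z≢y)) (cong suc (∣⟪&⟫∣ x≢y))

-- Covers and codegrees

module _ {n r} (H : Hypergraph n r) (intersecting : Intersecting H) (nonTrivial : NonTrivial H)
         (r-n : Large r n) where

  private
    N = triples n r
    M = pairs n r
    L = avoiding n r
    D = degreeBound n r

  Cover : Subset n → Set
  Cover K = ∀ {e} → e ∈E H → Nonempty (K ∩ e)

  -- The weighted codegree of `R`. The weight `ω` is constantly 1 or selects the edges that miss a
  -- given vertex.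
  W : (Subset n → ℕ) → Subset n → ℕ
  W ω R = sumL (edges H) (λ e → ω e * sub R e)

  codeg : Subset n → ℕ
  codeg R = sumL (edges H) (sub R)

  ∣edge∣ : ∀ {e} → e ∈E H → ∣ e ∣ ≡ r
  ∣edge∣ = All.lookup (uniform H)

  edge-cover : ∀ {f} → f ∈E H → Cover f
  edge-cover f∈H e∈H = intersecting f∈H e∈H

  deg≡codeg : ∀ v → deg H v ≡ codeg ⟪ v ⟫
  deg≡codeg v = trans (length-filter-∈ v (edges H)) (sumL-cong (edges H) (λ e → sym (sub-⁅⁆ v e)))

  W-1 : ∀ R → W (const 1) R ≡ codeg R
  W-1 R = sumL-cong (edges H) (λ e → *-identityˡ (sub R e))

  W≤codeg : ∀ {ω} → (∀ e → ω e ≤ 1) → ∀ R → W ω R ≤ codeg R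
  W≤codeg ω≤1 R = sumL-mono (edges H) (λ {e} _ →
    ≤-trans (*-monoˡ-≤ (sub R e) (ω≤1 e)) (≤-reflexive (*-identityˡ _)))

  cover? : ∀ K → Dec (Cover K)
  cover? K = map′ (λ all e∈ → All.lookup all e∈) (λ cover → All.tabulate cover)
    (All.all? (λ e → nonempty? (K ∩ e)) (edges H))

  missing-edge : ∀ {K} → ¬ Cover K → ∃ λ f → f ∈E H × Empty (K ∩ f)
  missing-edge {K} ¬cover = LM.find (¬All⇒Any¬ (λ e → nonempty? (K ∩ e)) (edges H)
    (λ all → ¬cover (λ e∈ → All.lookup all e∈)))

  -- Every edge meets the cover K, so each edge through R passes through some R ∪ {a} with a ∈ K.
  branch : ∀ ω R {K} → Cover K → W ω R ≤ sumOn K (λ a → W ω (R ⊕ a))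
  branch ω R {K} cover = ≤-trans (sumL-mono (edges H) split)
    (≤-reflexive (sumL-sumOn (edges H) K (λ e a → ω e * sub (R ⊕ a) e)))
    where
    split : ∀ {e} → e ∈E H → ω e * sub R e ≤ sumOn K (λ a → ω e * sub (R ⊕ a) e)
    split {e} e∈H with cover e∈H
    ... | a , a∈K∩e with x∈p∩q⁻ K e a∈K∩e
    ...   | a∈K , a∈e = ≤-trans (≤-reflexive (cong (ω e *_) (sym (sub-⊕-∈ R a∈e))))
                                 (sumOn-∈ (λ a → ω e * sub (R ⊕ a) e) a∈K)

  codeg-branch : ∀ R {K} → Cover K → codeg R ≤ sumOn K (λ a → codeg (R ⊕ a))
  codeg-branch R {K} cover = subst₂ _≤_ (W-1 R) (sumOn-cong K (λ a → W-1 (R ⊕ a))) (branch (const 1) R cover)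

  -- Edges through `R` and the non-edges marked by `v` are disjoint families of r-sets through `R`.
  codeg-avoid : ∀ R v → (∀ e → v e ≤ fits R ⊥ r e) → (∀ {e} → e ∈E H → v e ≡ 0) → ∣ R ∣ ≤ r →
    codeg R + sumAll n v ≤ (n ∸ ∣ R ∣) C (r ∸ ∣ R ∣)
  codeg-avoid R v v≤fits v-edge ∣R∣≤r = ≤-trans (sumL+sumAll≤sumAll (unique H) pointwise v≤fits)
    (≤-reflexive (trans (sumAll-fits-C {R = R} {⊥} (λ _ → ∉⊥) ∣R∣≤r)
                        (cong (λ s → (n ∸ s ∸ ∣ R ∣) C (r ∸ ∣ R ∣)) (∣⊥∣≡0 n))))
    where
    pointwise : ∀ {e} → e ∈E H → sub R e + v e ≤ fits R ⊥ r e
    pointwise {e} e∈H = ≤-reflexive (trans (cong₂ _+_ refl (v-edge e∈H))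
      (trans (+-identityʳ _) (sym (trans (fits-⊥ R r e)
        (trans (cong (λ k → sub R e * sized k e) (sym (∣edge∣ e∈H)))
          (trans (cong (sub R e *_) (sized-∣∣ e)) (*-identityʳ _)))))))

  codeg-≤ : ∀ R → ∣ R ∣ ≤ r → codeg R ≤ (n ∸ ∣ R ∣) C (r ∸ ∣ R ∣)
  codeg-≤ R ∣R∣≤r = ≤-trans (m≤m+n _ _) (codeg-avoid R (const 0) (λ _ → z≤n) (λ _ → refl) ∣R∣≤r)

  codeg-sized : ∀ R {k} → ∣ R ∣ ≡ k → k ≤ r → codeg R ≤ (n ∸ k) C (r ∸ k)
  codeg-sized R refl = codeg-≤ R

  codeg-pair : ∀ {x y} → x ≢ y → codeg ⟪ x & y ⟫ ≤ M
  codeg-pair x≢y = codeg-sized ⟪ _ & _ ⟫ (∣⟪&⟫∣ x≢y) (<⇒≤ (3≤r r-n))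

  codeg-triple : ∀ {x y z} → x ≢ y → z ≢ x → z ≢ y → codeg (⟪ x & y ⟫ ⊕ z) ≤ N
  codeg-triple x≢y z≢x z≢y = codeg-sized (⟪ _ & _ ⟫ ⊕ _) (∣triple∣ x≢y z≢x z≢y) (3≤r r-n)

  ∉-missing : ∀ {K f : Subset n} {x} → Empty (K ∩ f) → x ∈ K → x ∉ f
  ∉-missing {K} {f} empty x∈K x∈f = empty (_ , x∈p∩q⁺ (x∈K , x∈f))

  ∈⇒≢ : ∀ {p : Subset n} {x y} → x ∈ p → y ∉ p → x ≢ y
  ∈⇒≢ x∈p y∉p refl = y∉p x∈p

  x∈⟪x&y⟫ : ∀ (x y : Fin n) → x ∈ ⟪ x & y ⟫
  x∈⟪x&y⟫ x y = p⊆p⊕x ⟪ x ⟫ y (x∈p⊕x ⊥ x)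

  codeg-noncover : ∀ {x y} → x ≢ y → ¬ Cover ⟪ x & y ⟫ → codeg ⟪ x & y ⟫ ≤ r * N
  codeg-noncover {x} {y} x≢y ¬cover with missing-edge ¬cover
  ... | f , f∈H , empty = ≤-trans (codeg-branch ⟪ x & y ⟫ (edge-cover f∈H))
    (subst (λ s → sumOn f (λ a → codeg (⟪ x & y ⟫ ⊕ a)) ≤ s * N) (∣edge∣ f∈H)
      (sumOn-bound f λ a∈f → codeg-triple x≢y
        (∈⇒≢ a∈f (∉-missing empty (x∈⟪x&y⟫ x y)))
        (∈⇒≢ a∈f (∉-missing empty (x∈p⊕x ⟪ x ⟫ y)))))

  pair-cover : ∀ {x y} → Cover ⟪ x & y ⟫ → ∀ {e} → e ∈E H → x ∉ e → y ∈ e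
  pair-cover {x} {y} cover {e} e∈H x∉e with cover e∈H
  ... | z , z∈ with x∈p∩q⁻ ⟪ x & y ⟫ e z∈
  ...   | z∈xy , z∈e with ∈⊕⁻ ⟪ x ⟫ y z∈xy
  ...     | inj₁ refl = z∈e
  ...     | inj₂ z∈x with ∈⊕⁻ ⊥ x z∈x
  ...       | inj₁ refl = contradiction z∈e x∉e
  ...       | inj₂ z∈⊥  = contradiction z∈⊥ ∉⊥

  pair-cover-sym : ∀ {x y} → Cover ⟪ x & y ⟫ → Cover ⟪ y & x ⟫
  pair-cover-sym {x} {y} cover {e} e∈H with x ∈? e
  ... | yes x∈e = x , x∈p∩q⁺ (x∈p⊕x ⟪ y ⟫ x , x∈e)
  ... | no x∉e  = y , x∈p∩q⁺ (x∈⟪x&y⟫ y x , pair-cover cover e∈H x∉e)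

  avoid-vertex : ∀ v → ∃ λ f → f ∈E H × v ∉ f
  -- If the degenerate pair `v`, `v` were a cover, `v` would lie in every edge.
  avoid-vertex v with cover? ⟪ v & v ⟫
  ... | no ¬cover = case missing-edge ¬cover of λ
    { (f , f∈H , empty) → f , f∈H , ∉-missing empty (x∈p⊕x ⟪ v ⟫ v) }
  ... | yes cover = contradiction (v , λ {e} e∈H → case v ∈? e of λ
    { (yes v∈e) → v∈e ; (no v∉e) → pair-cover cover e∈H v∉e }) nonTrivial

  pair-cover-≢ : ∀ {x y} → Cover ⟪ x & y ⟫ → x ≢ y
  pair-cover-≢ {x} cover refl with avoid-vertex x
  ... | f , f∈H , x∉f = x∉f (pair-cover cover f∈H x∉f)

  -- Every case ends here. The selected set lies outside `T`, hence is disjoint from the edge `A`,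
  -- and so cannot be an edge itself.
  finish : ∀ {T A} → A ∈E H → A ⊆ T → r ≤ ∣ ∁ T ∣ → sumOn (∁ T) (codeg ∘ ⟪_⟫) ≤ ∣ ∁ T ∣ * D →
    OreDegree≤ H (r * D)
  finish {T} {A} A∈H A⊆T r≤∣∁T∣ avg
    with select (∣ ∁ T ∣ ∸ r) (∁ T) (sym (m∸n+n≡m r≤∣∁T∣)) avg
  ... | S , S⊆∁T , ∣S∣≡r , sum≤ = S , ∣S∣≡r , S∉H ,
    ≤-trans (≤-reflexive (trans (degSet≡sumOn H S) (sumOn-cong S deg≡codeg))) sum≤
    where
    S∉H : ¬ (S ∈E H)
    S∉H S∈H with intersecting S∈H A∈H
    ... | x , x∈ with x∈p∩q⁻ S A x∈
    ...   | x∈S , x∈A = x∈∁p⇒x∉p (S⊆∁T x∈S) (A⊆T x∈A)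

  ∣∁T∣-≥ : ∀ T {s} → ∣ T ∣ ≤ s → n ≤ ∣ ∁ T ∣ + s
  ∣∁T∣-≥ T {s} ∣T∣≤s = ≤-trans (m≤n+m∸n n ∣ T ∣)
    (≤-trans (+-mono-≤ ∣T∣≤s (≤-reflexive (sym (∣∁p∣≡n∸∣p∣ T)))) (≤-reflexive (+-comm s _)))

  r≤∣∁T∣ : ∀ T → ∣ T ∣ ≤ 2 * r + 1 → r ≤ ∣ ∁ T ∣
  r≤∣∁T∣ T ∣T∣≤ = +-cancelʳ-≤ (2 * r + 1) _ _ (≤-trans (3r+1≤n r-n) (∣∁T∣-≥ T ∣T∣≤))
    where
    3r+1≤n : ∀ {r n} → Large r n → r + (2 * r + 1) ≤ n
    3r+1≤n (large j _ t refl) = slack _ (poly j t)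
      where
      poly : ∀ j t → 3 + j + (2 * (3 + j) + 1) + (26 + 21 * j + 4 * (j * j) + t)
           ≡ 3 + (3 + j + (30 + 23 * j + 4 * (j * j) + t))
      poly = solve-∀

  sum-codeg : ∀ p → sumOn p (codeg ∘ ⟪_⟫) ≡ sumL (edges H) (λ e → sumOn p (ind e))
  sum-codeg p = trans (sym (sumL-sumOn (edges H) p (λ e u → sub ⟪ u ⟫ e)))
    (sumL-cong (edges H) (λ e → sumOn-cong p (λ u → sub-⁅⁆ u e)))

  -- Double counting of incidences; `codeg ⊥` is the number of edges.
  sum-codeg-≤ : ∀ p k → (∀ {e} → e ∈E H → sumOn p (ind e) ≤ k) → sumOn p (codeg ∘ ⟪_⟫) ≤ k * codeg ⊥
  sum-codeg-≤ p k f = ≤-trans (≤-reflexive (sum-codeg p)) (≤-trans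
    (sumL-mono (edges H) (λ {e} e∈H → ≤-trans (f e∈H) (≤-reflexive (sym (trans (cong (k *_) (sub-⊥ e)) (*-identityʳ k))))))
    (≤-reflexive (sumL-* (edges H) k (sub ⊥))))

  -- The cases with a covering pair

  triangle : ∀ {a b c} → Cover ⟪ a & b ⟫ → Cover ⟪ a & c ⟫ → Cover ⟪ b & c ⟫ → OreDegree≤ H (r * D)
  triangle {a} {b} {c} ab ac bc with avoid-vertex a
  ... | A , A∈H , _ = finish A∈H (p⊆p⊕x _ c ∘ p⊆p⊕x _ b ∘ p⊆p⊕x A a) (r≤∣∁T∣ T ∣T∣≤)
    (sumOn-bound (∁ T) (λ u∈ → ≤-trans (deg≤3N (x∈∁p⇒x∉p u∈)) (triples≤degreeBound r-n)))
    where
    T = A ⊕ a ⊕ b ⊕ c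
    ∣T∣≤ : ∣ T ∣ ≤ 2 * r + 1
    ∣T∣≤ = begin
      ∣ T ∣          ≤⟨ ∣p⊕x∣≤1+∣p∣ (A ⊕ a ⊕ b) c ⟩
      suc ∣ A ⊕ a ⊕ b ∣   ≤⟨ s≤s (∣p⊕x∣≤1+∣p∣ (A ⊕ a) b) ⟩
      suc (suc ∣ A ⊕ a ∣) ≤⟨ s≤s (s≤s (∣p⊕x∣≤1+∣p∣ A a)) ⟩
      3 + ∣ A ∣      ≡⟨ cong (3 +_) (∣edge∣ A∈H) ⟩
      3 + r          ≤⟨ +-monoˡ-≤ r (3≤r r-n) ⟩
      r + r          ≡⟨ cong (r +_) (+-identityʳ r) ⟨
      2 * r          ≤⟨ m≤m+n _ 1 ⟩
      2 * r + 1      ∎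
      where open ≤-Reasoning
    module _ {u} (u∉T : u ∉ T) where
      a≢u : a ≢ u
      a≢u refl = u∉T (p⊆p⊕x _ c (p⊆p⊕x _ b (x∈p⊕x A a)))
      b≢u : b ≢ u
      b≢u refl = u∉T (p⊆p⊕x _ c (x∈p⊕x _ b))
      c≢u : c ≢ u
      c≢u refl = u∉T (x∈p⊕x _ c)
      uab uac ubc : Subset n → ℕ
      uab = sub (⟪ u & a ⟫ ⊕ b)
      uac = sub (⟪ u & a ⟫ ⊕ c)
      ubc = sub (⟪ u & b ⟫ ⊕ c)
      two-in : ∀ {x y e} → x ∈ e → y ∈ e → sub ⟪ u ⟫ e ≤ sub (⟪ u & x ⟫ ⊕ y) e
      two-in {x} x∈e y∈e = ≤-reflexive (sym (trans (sub-⊕-∈ ⟪ u & x ⟫ y∈e) (sub-⊕-∈ ⟪ u ⟫ x∈e)))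
      -- An edge that misses one of `a`, `b`, `c` contains the other two.
      pointwise : ∀ {e} → e ∈E H → sub ⟪ u ⟫ e ≤ uab e + (uac e + ubc e)
      pointwise {e} e∈H with a ∈? e | b ∈? e
      ... | yes a∈e | yes b∈e = ≤-trans (two-in a∈e b∈e) (m≤m+n _ _)
      ... | yes a∈e | no b∉e  = ≤-trans (two-in a∈e (pair-cover bc e∈H b∉e))
                                  (≤-trans (m≤m+n _ _) (m≤n+m _ (uab e)))
      ... | no a∉e  | _       = ≤-trans (two-in (pair-cover ab e∈H a∉e) (pair-cover ac e∈H a∉e))
                                  (≤-trans (m≤n+m _ (uac e)) (m≤n+m _ (uab e)))
      deg≤3N : codeg ⟪ u ⟫ ≤ 3 * N
      deg≤3N = begin
        codeg ⟪ u ⟫                                    ≤⟨ sumL-mono (edges H) pointwise ⟩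
        sumL (edges H) (λ e → uab e + (uac e + ubc e)) ≡⟨ sumL-+ (edges H) uab _ ⟩
        sumL (edges H) uab + sumL (edges H) (λ e → uac e + ubc e)
          ≡⟨ cong (sumL (edges H) uab +_) (sumL-+ (edges H) uac ubc) ⟩
        sumL (edges H) uab + (sumL (edges H) uac + sumL (edges H) ubc)
          ≤⟨ +-mono-≤ (codeg-triple (≢-sym a≢u) b≢u (≢-sym (pair-cover-≢ ab)))
               (+-mono-≤ (codeg-triple (≢-sym a≢u) c≢u (≢-sym (pair-cover-≢ ac)))
                         (codeg-triple (≢-sym b≢u) c≢u (≢-sym (pair-cover-≢ bc)))) ⟩
        N + (N + N)                                    ≡⟨ cong (λ z → N + (N + z)) (+-identityʳ N) ⟨
        3 * N                                          ∎
        where open ≤-Reasoning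

  -- Take `A` missing `a` and `B` missing `b`; then `b ∈ A` and `a ∈ B`. An edge through `a` meets
  -- `A` in a second point of `A ∪ B`, and an edge missing `a` contains `b` and meets `B` in a
  -- second point.
  single-edge : ∀ {a b} → Cover ⟪ a & b ⟫ → (∀ {x} → x ≢ a → x ≢ b → ¬ Cover ⟪ a & x ⟫) →
    (∀ {x} → x ≢ a → x ≢ b → ¬ Cover ⟪ b & x ⟫) → OreDegree≤ H (r * D)
  single-edge {a} {b} ab ¬ax ¬bx with avoid-vertex a | avoid-vertex b
  ... | A , A∈H , a∉A | B , B∈H , b∉B =
    finish A∈H (p⊆p∪q B) (r≤∣∁T∣ T (≤-trans ∣T∣≤ (m≤m+n _ 1)))
      (≤-trans (sum-codeg-≤ (∁ T) (r ∸ 2) two-in-T)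
        (≤-trans (*-monoʳ-≤ (r ∸ 2) size) (kernel-average ∣ ∁ T ∣ r-n (∣∁T∣-≥ T ∣T∣≤))))
    where
    T = A ∪ B
    b∈A = pair-cover ab A∈H a∉A
    a∈B = pair-cover (pair-cover-sym ab) B∈H b∉B
    ∣T∣≤ : ∣ T ∣ ≤ 2 * r
    ∣T∣≤ = ≤-trans (∣p∪q∣≤∣p∣+∣q∣ A B)
      (≤-reflexive (cong₂ _+_ (∣edge∣ A∈H) (trans (∣edge∣ B∈H) (sym (+-identityʳ r)))))
    two-in-T : ∀ {e} → e ∈E H → sumOn (∁ T) (ind e) ≤ r ∸ 2
    two-in-T {e} e∈H = subst (λ s → sumOn (∁ T) (ind e) ≤ s ∸ 2) (∣edge∣ e∈H) few-outside
      where
      few-outside : sumOn (∁ T) (ind e) ≤ ∣ e ∣ ∸ 2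
      few-outside with a ∈? e
      ... | yes a∈e with intersecting A∈H e∈H
      ...   | y , y∈ with x∈p∩q⁻ A e y∈
      ...     | y∈A , y∈e = outside-two (q⊆p∪q A B a∈B) a∈e (p⊆p∪q B y∈A) y∈e (≢-sym (∈⇒≢ y∈A a∉A))
      few-outside | no a∉e with intersecting B∈H e∈H
      ... | y , y∈ with x∈p∩q⁻ B e y∈
      ...   | y∈B , y∈e = outside-two (p⊆p∪q B b∈A) (pair-cover ab e∈H a∉e) (q⊆p∪q A B y∈B) y∈e
                            (≢-sym (∈⇒≢ y∈B b∉B))
    -- An edge through `x` meets `F`. Only `y` can form a covering pair with `x`, and the other
    -- points of `F` contribute at most `r * N` each.
    deg≤ : ∀ {x y F} → Cover ⟪ x & y ⟫ → F ∈E H → x ∉ F →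
      (∀ {z} → z ≢ x → z ≢ y → ¬ Cover ⟪ x & z ⟫) → codeg ⟪ x ⟫ ≤ M + r * (r * N)
    deg≤ {x} {y} {F} xy F∈H x∉F ¬xz = ≤-trans (codeg-branch ⟪ x ⟫ (edge-cover F∈H))
      (subst (λ s → sumOn F (λ z → codeg ⟪ x & z ⟫) ≤ M + s * (r * N)) (∣edge∣ F∈H)
        (sumOn-except F y
          (λ z∈F z≢y → codeg-noncover (≢-sym (∈⇒≢ z∈F x∉F)) (¬xz (∈⇒≢ z∈F x∉F) z≢y))
          (codeg-pair (pair-cover-≢ xy))))
    size : codeg ⊥ ≤ 2 * (M + r * (r * N))
    size = ≤-trans (codeg-branch ⊥ ab)
      (subst (λ s → sumOn ⟪ a & b ⟫ (codeg ∘ ⟪_⟫) ≤ s * (M + r * (r * N))) (∣⟪&⟫∣ (pair-cover-≢ ab))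
        (sumOn-bound ⟪ a & b ⟫ λ x∈ → case ∈⊕⁻ ⟪ a ⟫ b x∈ of λ
          { (inj₁ refl) → deg≤ (pair-cover-sym ab) B∈H b∉B (λ z≢b z≢a → ¬bx z≢a z≢b)
          ; (inj₂ x∈a) → case ∈⊕⁻ ⊥ a x∈a of λ
            { (inj₁ refl) → deg≤ ab A∈H a∉A ¬ax
            ; (inj₂ x∈⊥) → contradiction x∈⊥ ∉⊥ } }))

  cherry : ∀ {v a b} → Cover ⟪ v & a ⟫ → Cover ⟪ v & b ⟫ → a ≢ b → ¬ Cover ⟪ a & b ⟫ → OreDegree≤ H (r * D)
  cherry {v} {a} {b} va vb a≢b ¬ab with avoid-vertex v
  -- The search is for an edge that misses `v` and some point of `A`. If there is none, each edge
  -- missing `v` contains `A` and hence equals it by size.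
  ... | A , A∈H , v∉A = case Any.any? (λ e → ¬? (v ∈? e) ×-dec any? (λ x → x ∈? A ×-dec ¬? (x ∈? e))) (edges H) of λ
    { (yes found) → case LM.find found of λ { (B , B∈H , v∉B , x , x∈A , x∉B) → two B∈H v∉B x∈A x∉B }
    ; (no none)   → one (λ {e} e∈H v∉e {x} x∈A → case x ∈? e of λ
        { (yes x∈e) → x∈e
        ; (no x∉e)  → contradiction (Any.map (λ { refl → v∉e , x , x∈A , x∉e }) e∈H) none }) }
    where
    -- For `F = A` these r-sets are non-edges, and their number is exactly the binomial subtracted
    -- in `D`.
    uv-avoid : ∀ {F u} → u ≢ v → u ∉ F → v ∉ F → sumAll n (fits ⟪ u & v ⟫ F r) ≡ (n ∸ ∣ F ∣ ∸ 2) C (r ∸ 2)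
    uv-avoid {F} {u} u≢v u∉F v∉F =
      trans (sumAll-fits-C {R = ⟪ u & v ⟫} {F} (λ {x} x∈ x∈F → case ∈⊕⁻ ⟪ u ⟫ v x∈ of λ
              { (inj₁ refl) → v∉F x∈F
              ; (inj₂ x∈u) → case ∈⊕⁻ ⊥ u x∈u of λ { (inj₁ refl) → u∉F x∈F ; (inj₂ x∈⊥) → ∉⊥ x∈⊥ } })
              (subst (_≤ r) (sym (∣⟪&⟫∣ u≢v)) (<⇒≤ (3≤r r-n))))
            (cong (λ s → (n ∸ ∣ F ∣ ∸ s) C (r ∸ s)) (∣⟪&⟫∣ u≢v))

    fits-meets : ∀ R {F e} → Nonempty (F ∩ e) → fits R F r e ≡ 0
    fits-meets R {F} {e} (x , x∈) with x∈p∩q⁻ F e x∈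
    ... | x∈F , x∈e = trans (cong (λ z → sub R e * z * sized r e) (sub-∌ x∈F (x∈p⇒x∉∁p x∈e)))
                            (cong (_* sized r e) (*-zeroʳ (sub R e)))

    one : (∀ {e} → e ∈E H → v ∉ e → A ⊆ e) → OreDegree≤ H (r * D)
    one A⊆ = finish A∈H (p⊆p⊕x A v) (r≤∣∁T∣ T ∣T∣≤) (sumOn-bound (∁ T) (λ u∈ → deg≤D (x∈∁p⇒x∉p u∈)))
      where
      T = A ⊕ v
      ∣T∣≤ : ∣ T ∣ ≤ 2 * r + 1
      ∣T∣≤ = begin
        ∣ A ⊕ v ∣   ≤⟨ ∣p⊕x∣≤1+∣p∣ A v ⟩
        1 + ∣ A ∣   ≡⟨ cong suc (∣edge∣ A∈H) ⟩
        1 + r       ≡⟨ +-comm 1 r ⟩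
        r + 1       ≤⟨ +-monoˡ-≤ 1 (m≤m+n r _) ⟩
        2 * r + 1   ∎
        where open ≤-Reasoning
      deg≤D : ∀ {u} → u ∉ T → codeg ⟪ u ⟫ ≤ D
      deg≤D {u} u∉T = +-cancelʳ-≤ ((n ∸ r ∸ 2) C (r ∸ 2)) _ _ (begin
        codeg ⟪ u ⟫ + (n ∸ r ∸ 2) C (r ∸ 2)
          ≤⟨ +-monoˡ-≤ _ (sumL-mono (edges H) pointwise) ⟩
        codeg ⟪ u & v ⟫ + (n ∸ r ∸ 2) C (r ∸ 2)
          ≡⟨ cong (codeg ⟪ u & v ⟫ +_) (trans (uv-avoid u≢v u∉A v∉A) (cong (λ s → (n ∸ s ∸ 2) C (r ∸ 2)) (∣edge∣ A∈H))) ⟨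
        codeg ⟪ u & v ⟫ + sumAll n (fits ⟪ u & v ⟫ A r)
          ≤⟨ codeg-avoid ⟪ u & v ⟫ (fits ⟪ u & v ⟫ A r)
               (λ e → *-monoˡ-≤ (sized r e) (*-monoʳ-≤ (sub ⟪ u & v ⟫ e) (≤-trans (sub≤1 A (∁ e)) (≤-reflexive (sym (sub-⊥ (∁ e)))))))
               (λ e∈H → fits-meets ⟪ u & v ⟫ (intersecting A∈H e∈H))
               (subst (_≤ r) (sym (∣⟪&⟫∣ u≢v)) (<⇒≤ (3≤r r-n))) ⟩
        (n ∸ ∣ ⟪ u & v ⟫ ∣) C (r ∸ ∣ ⟪ u & v ⟫ ∣)
          ≡⟨ cong (λ s → (n ∸ s) C (r ∸ s)) (∣⟪&⟫∣ u≢v) ⟩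
        M
          ≡⟨ avoiding-pairs r-n ⟨
        (n ∸ r ∸ 2) C (r ∸ 2) + D
          ≡⟨ +-comm _ D ⟩
        D + (n ∸ r ∸ 2) C (r ∸ 2) ∎)
        where
        open ≤-Reasoning
        u≢v : u ≢ v
        u≢v refl = u∉T (x∈p⊕x A v)
        u∉A : u ∉ A
        u∉A = u∉T ∘ p⊆p⊕x A v
        pointwise : ∀ {e} → e ∈E H → sub ⟪ u ⟫ e ≤ sub ⟪ u & v ⟫ e
        pointwise {e} e∈H with v ∈? e
        ... | yes v∈e = ≤-reflexive (sym (sub-⊕-∈ ⟪ u ⟫ v∈e))
        ... | no v∉e = ≤-trans (≤-reflexive (trans (sub-⁅⁆ u e) (ind-∉ u∉e))) z≤n
          where
          u∉e : u ∉ e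
          -- Otherwise `A` would be a proper subset of `e`, although both have `r` points.
          u∉e u∈e = <-irrefl (trans (∣edge∣ A∈H) (sym (∣edge∣ e∈H))) (p⊂q⇒∣p∣<∣q∣ (A⊆ e∈H v∉e , u , u∈e , u∉A))

    -- The degree of `u` splits into its codegree with `v`, at most `D - L`, and the edges through
    -- `u` that miss `v`. Summed over all `u` outside `T`, the latter cost at most `∣ ∁ T ∣ * L`.
    two : ∀ {B x} → B ∈E H → v ∉ B → x ∈ A → x ∉ B → OreDegree≤ H (r * D)
    two {B} {x} B∈H v∉B x∈A x∉B = finish A∈H (p⊆p⊕x _ v ∘ p⊆p∪q B) (r≤∣∁T∣ T ∣T∣≤) (begin
      sumOn (∁ T) (codeg ∘ ⟪_⟫)
        ≤⟨ sumOn-mono (∁ T) (λ {u} _ → split u) ⟩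
      sumOn (∁ T) (λ u → codeg ⟪ u & v ⟫ + W ω ⟪ u ⟫)
        ≡⟨ sumOn-+ (∁ T) (λ u → codeg ⟪ u & v ⟫) (λ u → W ω ⟪ u ⟫) ⟩
      sumOn (∁ T) (λ u → codeg ⟪ u & v ⟫) + sumOn (∁ T) (λ u → W ω ⟪ u ⟫)
        ≤⟨ +-monoʳ-≤ _ (≤-trans avoiders (star-average ∣ ∁ T ∣ r-n (∣∁T∣-≥ T ∣T∣≤))) ⟩
      sumOn (∁ T) (λ u → codeg ⟪ u & v ⟫) + ∣ ∁ T ∣ * L
        ≡⟨ cong (sumOn (∁ T) (λ u → codeg ⟪ u & v ⟫) +_) (sumOn-const (∁ T) L) ⟨
      sumOn (∁ T) (λ u → codeg ⟪ u & v ⟫) + sumOn (∁ T) (const L)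
        ≡⟨ sumOn-+ (∁ T) (λ u → codeg ⟪ u & v ⟫) (const L) ⟨
      sumOn (∁ T) (λ u → codeg ⟪ u & v ⟫ + L)
        ≤⟨ sumOn-bound (∁ T) (λ u∈ → star≤ (x∈∁p⇒x∉p u∈)) ⟩
      ∣ ∁ T ∣ * D ∎)
      where
      open ≤-Reasoning
      T = (A ∪ B) ⊕ v
      ω : Subset n → ℕ
      ω e = 1 ∸ ind e v
      ∣T∣≤ : ∣ T ∣ ≤ 2 * r + 1
      ∣T∣≤ = begin
        ∣ T ∣               ≤⟨ ∣p⊕x∣≤1+∣p∣ (A ∪ B) v ⟩
        1 + ∣ A ∪ B ∣       ≤⟨ s≤s (∣p∪q∣≤∣p∣+∣q∣ A B) ⟩
        1 + (∣ A ∣ + ∣ B ∣) ≡⟨ cong₂ (λ s t → 1 + (s + t)) (∣edge∣ A∈H) (trans (∣edge∣ B∈H) (sym (+-identityʳ r))) ⟩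
        1 + 2 * r           ≡⟨ +-comm 1 (2 * r) ⟩
        2 * r + 1           ∎
      a∈T : a ∈ T
      a∈T = p⊆p⊕x _ v (p⊆p∪q B (pair-cover va A∈H v∉A))
      b∈T : b ∈ T
      b∈T = p⊆p⊕x _ v (p⊆p∪q B (pair-cover vb A∈H v∉A))
      split : ∀ u → codeg ⟪ u ⟫ ≤ codeg ⟪ u & v ⟫ + W ω ⟪ u ⟫
      split u = ≤-trans (sumL-mono (edges H) (λ {e} _ → pointwise e))
        (≤-reflexive (sumL-+ (edges H) (sub ⟪ u & v ⟫) (λ e → ω e * sub ⟪ u ⟫ e)))
        where
        pointwise : ∀ e → sub ⟪ u ⟫ e ≤ sub ⟪ u & v ⟫ e + ω e * sub ⟪ u ⟫ e
        pointwise e with v ∈? e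
        ... | yes v∈e = ≤-trans (≤-reflexive (sym (sub-⊕-∈ ⟪ u ⟫ v∈e))) (m≤m+n _ _)
        ... | no v∉e  = ≤-trans (≤-reflexive (sym (trans (cong (λ i → (1 ∸ i) * sub ⟪ u ⟫ e) (ind-∉ v∉e)) (*-identityˡ _)))) (m≤n+m _ _)
      -- An edge missing `v` contains `a` and `b`, both in `T`, so it has at most `r ∸ 2` points
      -- outside. The number of such edges is at most the codegree of `a` and `b`.
      avoiders : sumOn (∁ T) (λ u → W ω ⟪ u ⟫) ≤ (r ∸ 2) * (r * N)
      avoiders = begin
        sumOn (∁ T) (λ u → W ω ⟪ u ⟫)
          ≡⟨ sumL-sumOn (edges H) (∁ T) (λ e u → ω e * sub ⟪ u ⟫ e) ⟨
        sumL (edges H) (λ e → sumOn (∁ T) (λ u → ω e * sub ⟪ u ⟫ e))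
          ≤⟨ sumL-mono (edges H) pointwise ⟩
        sumL (edges H) (λ e → (r ∸ 2) * sub ⟪ a & b ⟫ e)
          ≡⟨ sumL-* (edges H) (r ∸ 2) (sub ⟪ a & b ⟫) ⟩
        (r ∸ 2) * codeg ⟪ a & b ⟫
          ≤⟨ *-monoʳ-≤ (r ∸ 2) (codeg-noncover a≢b ¬ab) ⟩
        (r ∸ 2) * (r * N) ∎
        where
        pointwise : ∀ {e} → e ∈E H → sumOn (∁ T) (λ u → ω e * sub ⟪ u ⟫ e) ≤ (r ∸ 2) * sub ⟪ a & b ⟫ e
        pointwise {e} e∈H with v ∈? e
        ... | yes v∈e = ≤-trans
          (≤-reflexive (trans (sumOn-cong (∁ T) (λ u → cong (λ i → (1 ∸ i) * sub ⟪ u ⟫ e) (ind-∈ v∈e)))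
            (trans (sumOn-const (∁ T) 0) (*-zeroʳ ∣ ∁ T ∣)))) z≤n
        ... | no v∉e = begin
          sumOn (∁ T) (λ u → ω e * sub ⟪ u ⟫ e)
            ≡⟨ sumOn-cong (∁ T) (λ u → trans (cong (λ i → (1 ∸ i) * sub ⟪ u ⟫ e) (ind-∉ v∉e)) (trans (*-identityˡ _) (sub-⁅⁆ u e))) ⟩
          sumOn (∁ T) (ind e)
            ≤⟨ outside-two a∈T a∈e b∈T b∈e a≢b ⟩
          ∣ e ∣ ∸ 2
            ≡⟨ cong (_∸ 2) (∣edge∣ e∈H) ⟩
          r ∸ 2
            ≡⟨ *-identityʳ (r ∸ 2) ⟨
          (r ∸ 2) * 1
            ≡⟨ cong ((r ∸ 2) *_) (trans (sub-⊕-∈ ⟪ a ⟫ b∈e) (trans (sub-⁅⁆ a e) (ind-∈ a∈e))) ⟨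
          (r ∸ 2) * sub ⟪ a & b ⟫ e ∎
          where
          a∈e = pair-cover va e∈H v∉e
          b∈e = pair-cover vb e∈H v∉e
      -- The r-sets through u and v that avoid A, and those through u, v and x ∈ A that avoid B, are not edges.
      star≤ : ∀ {u} → u ∉ T → codeg ⟪ u & v ⟫ + L ≤ D
      star≤ {u} u∉T = +-cancelʳ-≤ ((n ∸ r ∸ 2) C (r ∸ 2)) _ _ (begin
        codeg uv + L + (n ∸ r ∸ 2) C (r ∸ 2)
          ≡⟨ shuffle (codeg uv) L _ ⟩
        codeg uv + ((n ∸ r ∸ 2) C (r ∸ 2) + L)
          ≡⟨ cong (codeg uv +_) (cong₂ _+_
               (trans (uv-avoid u≢v u∉A v∉A) (cong (λ s → (n ∸ s ∸ 2) C (r ∸ 2)) (∣edge∣ A∈H))) uvx-avoid) ⟨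
        codeg uv + (sumAll n (fits uv A r) + sumAll n (fits (uv ⊕ x) B r))
          ≡⟨ cong (codeg uv +_) (sumAll-+ n (fits uv A r) (fits (uv ⊕ x) B r)) ⟨
        codeg uv + sumAll n (λ e → fits uv A r e + fits (uv ⊕ x) B r e)
          ≤⟨ codeg-avoid uv (λ e → fits uv A r e + fits (uv ⊕ x) B r e) exclusive
               (λ e∈H → cong₂ _+_ (fits-meets uv (intersecting A∈H e∈H)) (fits-meets (uv ⊕ x) (intersecting B∈H e∈H)))
               (subst (_≤ r) (sym (∣⟪&⟫∣ u≢v)) (<⇒≤ (3≤r r-n))) ⟩
        (n ∸ ∣ uv ∣) C (r ∸ ∣ uv ∣)
          ≡⟨ cong (λ s → (n ∸ s) C (r ∸ s)) (∣⟪&⟫∣ u≢v) ⟩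
        M
          ≡⟨ avoiding-pairs r-n ⟨
        (n ∸ r ∸ 2) C (r ∸ 2) + D
          ≡⟨ +-comm _ D ⟩
        D + (n ∸ r ∸ 2) C (r ∸ 2) ∎)
        where
        uv = ⟪ u & v ⟫
        shuffle : ∀ a b c → a + b + c ≡ a + (c + b)
        shuffle = solve-∀
        u≢v : u ≢ v
        u≢v refl = u∉T (x∈p⊕x (A ∪ B) v)
        u∉A : u ∉ A
        u∉A = u∉T ∘ p⊆p⊕x _ v ∘ p⊆p∪q B
        u∉B : u ∉ B
        u∉B = u∉T ∘ p⊆p⊕x _ v ∘ q⊆p∪q A B
        ∣uvx∣ : ∣ uv ⊕ x ∣ ≡ 3
        ∣uvx∣ = ∣triple∣ u≢v (∈⇒≢ x∈A u∉A) (∈⇒≢ x∈A v∉A)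
        uvx-avoid : sumAll n (fits (uv ⊕ x) B r) ≡ L
        uvx-avoid = trans (sumAll-fits-C {R = uv ⊕ x} {B} disjoint (subst (_≤ r) (sym ∣uvx∣) (3≤r r-n)))
          (cong₂ (λ s t → (n ∸ t ∸ s) C (r ∸ s)) ∣uvx∣ (∣edge∣ B∈H))
          where
          disjoint : ∀ {y} → y ∈ uv ⊕ x → y ∉ B
          disjoint {y} y∈ y∈B with ∈⊕⁻ uv x y∈
          ... | inj₁ refl = x∉B y∈B
          ... | inj₂ y∈uv with ∈⊕⁻ ⟪ u ⟫ v y∈uv
          ...   | inj₁ refl = v∉B y∈B
          ...   | inj₂ y∈u with ∈⊕⁻ ⊥ u y∈u
          ...     | inj₁ refl = u∉B y∈B
          ...     | inj₂ y∈⊥  = ∉⊥ y∈⊥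
        -- No set is marked twice: the first family avoids `A`, while the second contains `x ∈ A`.
        exclusive : ∀ e → fits uv A r e + fits (uv ⊕ x) B r e ≤ fits uv ⊥ r e
        exclusive e with x ∈? e
        ... | yes x∈e = begin
          sub uv e * sub A (∁ e) * sized r e + sub (uv ⊕ x) e * sub B (∁ e) * sized r e
            ≡⟨ cong (_+ fits (uv ⊕ x) B r e) (fits-meets uv (x , x∈p∩q⁺ (x∈A , x∈e))) ⟩
          sub (uv ⊕ x) e * sub B (∁ e) * sized r e
            ≤⟨ *-monoˡ-≤ (sized r e) (*-mono-≤ (≤-reflexive (sub-⊕-∈ uv x∈e)) (≤-trans (sub≤1 B (∁ e)) (≤-reflexive (sym (sub-⊥ (∁ e)))))) ⟩
          fits uv ⊥ r e ∎
        ... | no x∉e = begin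
          fits uv A r e + sub (uv ⊕ x) e * sub B (∁ e) * sized r e
            ≡⟨ cong (λ z → fits uv A r e + z * sub B (∁ e) * sized r e) (sub-⊕-∉ uv x∉e) ⟩
          fits uv A r e + 0
            ≡⟨ +-identityʳ _ ⟩
          fits uv A r e
            ≤⟨ *-monoˡ-≤ (sized r e) (*-monoʳ-≤ (sub uv e) (≤-trans (sub≤1 A (∁ e)) (≤-reflexive (sym (sub-⊥ (∁ e)))))) ⟩
          fits uv ⊥ r e ∎

  -- Greedy covers and the case without covering pairs

  -- While some edge misses R, one of its r vertices lies in at least 1/r of the edges through R.
  grow : ∀ ω k R → n ≤ ∣ R ∣ + k → W ω ⊥ ≤ r ^ ∣ R ∣ * W ω R →
    ∃ λ K → Cover K × W ω ⊥ ≤ r ^ ∣ K ∣ * W ω K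
  grow ω k R n≤ W≤ with cover? R
  ... | yes cover = R , cover , W≤
  ... | no ¬cover with missing-edge ¬cover
  ...   | f , f∈H , empty with argmax f (λ a → W ω (R ⊕ a))
                                 (∣p∣>0⇒Nonempty f (subst (0 <_) (sym (∣edge∣ f∈H)) (<-≤-trans (s≤s z≤n) (3≤r r-n))))
  ...     | a , a∈f , max = next k n≤
    where
    a∉R : a ∉ R
    a∉R a∈R = ∉-missing empty a∈R a∈f
    R⊕a≡ : ∣ R ⊕ a ∣ ≡ suc ∣ R ∣
    R⊕a≡ = ∣p⊕x∣≡1+∣p∣ a∉R
    swap : ∀ x y z → x * (y * z) ≡ y * x * z
    swap = solve-∀
    W≤′ : W ω ⊥ ≤ r ^ ∣ R ⊕ a ∣ * W ω (R ⊕ a)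
    W≤′ = begin
      W ω ⊥                              ≤⟨ W≤ ⟩
      r ^ ∣ R ∣ * W ω R                   ≤⟨ *-monoʳ-≤ (r ^ ∣ R ∣) (≤-trans (branch ω R (edge-cover f∈H)) (sumOn-bound f max)) ⟩
      r ^ ∣ R ∣ * (∣ f ∣ * W ω (R ⊕ a))    ≡⟨ cong (λ s → r ^ ∣ R ∣ * (s * W ω (R ⊕ a))) (∣edge∣ f∈H) ⟩
      r ^ ∣ R ∣ * (r * W ω (R ⊕ a))       ≡⟨ swap (r ^ ∣ R ∣) r _ ⟩
      r ^ suc ∣ R ∣ * W ω (R ⊕ a)         ≡⟨ cong (λ s → r ^ s * W ω (R ⊕ a)) R⊕a≡ ⟨
      r ^ ∣ R ⊕ a ∣ * W ω (R ⊕ a)         ∎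
      where open ≤-Reasoning
    -- `k` bounds the number of vertices outside `R`. At `zero` the set `R ⊕ a` would have more than
    -- `n` points.
    next : ∀ k → n ≤ ∣ R ∣ + k → ∃ λ K → Cover K × W ω ⊥ ≤ r ^ ∣ K ∣ * W ω K
    next zero    n≤ = contradiction
      (≤-trans (≤-reflexive (sym R⊕a≡)) (≤-trans (∣p∣≤n (R ⊕ a)) (≤-trans n≤ (≤-reflexive (+-identityʳ ∣ R ∣)))))
      1+n≰n
    next (suc k) n≤ = grow ω k (R ⊕ a)
      (≤-trans n≤ (≤-reflexive (trans (+-suc ∣ R ∣ k) (cong (_+ k) (sym R⊕a≡))))) W≤′

  greedy-cover-size : ∀ {ω K} → (∀ e → ω e ≤ 1) → 2 * (r * (r * N)) < W ω ⊥ → W ω ⊥ ≤ r ^ ∣ K ∣ * W ω K →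
    ∣ K ∣ ≤ r → ∣ K ∣ * ∣ K ∣ ≤ 3 * r
  greedy-cover-size {ω} {K} ω≤1 big W≤ ∣K∣≤r = cover-size r-n ∣ K ∣ ∣K∣≤r
    (<-≤-trans big (≤-trans W≤ (*-monoʳ-≤ (r ^ ∣ K ∣) (≤-trans (W≤codeg ω≤1 K) (codeg-≤ K ∣K∣≤r)))))

  -- The weight through the greedy cover `K` is positive, so `K` lies in an edge `e` with `0 < ω e`.
  -- This gives `∣ K ∣ ≤ r`, as the size estimate requires, and later shows which vertices `K`
  -- misses.
  small-cover : ∀ ω → (∀ e → ω e ≤ 1) → 2 * (r * (r * N)) < W ω ⊥ →
    ∃ λ K → Cover K × ∣ K ∣ * ∣ K ∣ ≤ 3 * r × ∃ λ e → 0 < ω e × K ⊆ e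
  small-cover ω ω≤1 big =
    let
      K , cover , W≤ = grow ω n ⊥ (m≤n+m n _)
        (≤-reflexive (sym (trans (cong (λ s → r ^ s * W ω ⊥) (∣⊥∣≡0 n)) (*-identityˡ (W ω ⊥)))))
      e , e∈H , positive = sumL-witness (edges H) (λ e → ω e * sub K e)
        (factor>0 (W ω K) (subst (0 <_) (*-comm (r ^ ∣ K ∣) (W ω K)) (<-≤-trans (≤-<-trans z≤n big) W≤)))
      K⊆e = sub>0⇒⊆ K e (factor>0 (sub K e) (subst (0 <_) (*-comm (ω e) (sub K e)) positive))
    in K , cover ,
       greedy-cover-size {ω} {K} ω≤1 big W≤ (subst (∣ K ∣ ≤_) (∣edge∣ e∈H) (p⊆q⇒∣p∣≤∣q∣ K⊆e)) ,
       e , factor>0 (ω e) positive , λ {x} → K⊆e {x}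
    where
    factor>0 : ∀ x {y} → 0 < x * y → 0 < x
    factor>0 (suc x) _ = s≤s z≤n

  module _ (¬pair : ∀ {x y} → x ≢ y → ¬ Cover ⟪ x & y ⟫) where

    deg-≤-cover : ∀ {x K} → Cover K → x ∉ K → codeg ⟪ x ⟫ ≤ ∣ K ∣ * (r * N)
    deg-≤-cover {x} {K} cover x∉K = ≤-trans (codeg-branch ⟪ x ⟫ cover)
      (sumOn-bound K (λ a∈K → codeg-noncover (≢-sym (∈⇒≢ a∈K x∉K)) (¬pair (≢-sym (∈⇒≢ a∈K x∉K)))))

    -- At most `X` edges contain `x`, so more than `2 * X` miss it. The small cover obtained from
    -- these lies in an edge missing `x`, and branching along it bounds the degree of `x`.
    deg-small-cover : 3 * (r * (r * N)) < codeg ⊥ → ∀ x →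
      ∃ λ ρ → ρ * ρ ≤ 3 * r × codeg ⟪ x ⟫ ≤ ρ * (r * N)
    deg-small-cover big x =
      let K , cover , ρ²≤3r , e , ωe>0 , K⊆e = small-cover ω (λ e → m∸n≤m 1 (ind e x)) big′
      in ∣ K ∣ , ρ²≤3r , deg-≤-cover cover (x∉ ωe>0 ∘ K⊆e)
      where
      ω : Subset n → ℕ
      ω e = 1 ∸ ind e x
      X = r * (r * N)
      x∉ : ∀ {e} → 0 < ω e → x ∉ e
      x∉ ωe>0 x∈e = contradiction (subst (λ i → 0 < 1 ∸ i) (ind-∈ x∈e) ωe>0) λ ()
      deg≤X : codeg ⟪ x ⟫ ≤ X
      deg≤X =
        let f , f∈H , x∉f = avoid-vertex x
        in subst (λ s → codeg ⟪ x ⟫ ≤ s * (r * N)) (∣edge∣ f∈H) (deg-≤-cover (edge-cover f∈H) x∉f)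
      pointwise : ∀ e → sub ⊥ e ≤ sub ⟪ x ⟫ e + ω e * sub ⊥ e
      pointwise e = ≤-reflexive (trans (sub-⊥ e) (sym (trans
        (cong₂ _+_ (sub-⁅⁆ x e) (trans (cong (ω e *_) (sub-⊥ e)) (*-identityʳ (ω e))))
        (m+[n∸m]≡n (bit≤1 (lookup e x))))))
      big′ : 2 * X < W ω ⊥
      big′ = +-cancelˡ-< X _ _ (begin-strict
        X + 2 * X                   <⟨ big ⟩
        codeg ⊥                     ≤⟨ sumL-mono (edges H) (λ {e} _ → pointwise e) ⟩
        sumL (edges H) (λ e → sub ⟪ x ⟫ e + ω e * sub ⊥ e)  ≡⟨ sumL-+ (edges H) (sub ⟪ x ⟫) (λ e → ω e * sub ⊥ e) ⟩
        codeg ⟪ x ⟫ + W ω ⊥         ≤⟨ +-monoˡ-≤ (W ω ⊥) deg≤X ⟩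
        X + W ω ⊥                   ∎)
        where open ≤-Reasoning

    -- Multiplies two bounds of size √(3 r) without square roots.
    product-≤ : ∀ s t → s * s ≤ 3 * r → t * t ≤ 3 * r → s * t ≤ 3 * r
    product-≤ s t s²≤ t²≤ with ≤-total s t
    ... | inj₁ s≤t = ≤-trans (*-monoˡ-≤ t s≤t) t²≤
    ... | inj₂ t≤s = ≤-trans (*-monoʳ-≤ s t≤s) s²≤

    size-≤ : codeg ⊥ ≤ 3 * (r * (r * N))
    size-≤ = ≮⇒≥ λ big → <⇒≱ big (big-≤ big)
      where
      open ≤-Reasoning
      big-≤ : 3 * (r * (r * N)) < codeg ⊥ → codeg ⊥ ≤ 3 * (r * (r * N))
      big-≤ big =
        let
          K , cover , ρ²≤3r , _ = small-cover (const 1) (λ _ → ≤-refl)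
            (<-≤-trans (≤-<-trans (*-monoˡ-≤ (r * (r * N)) (m≤n+m 2 1)) big) (≤-reflexive (sym (W-1 ⊥))))
          -- Some edge exists and meets `K`, so `K` is nonempty and has a vertex `a` of largest
          -- degree.
          f , f∈H , _ = sumL-witness (edges H) (sub ⊥) (≤-<-trans z≤n big)
          y , y∈ = cover f∈H
          a , a∈K , max = argmax K (codeg ∘ ⟪_⟫) (y , proj₁ (x∈p∩q⁻ K f y∈))
          σ , σ²≤3r , deg≤ = deg-small-cover big a
        in begin
          codeg ⊥                         ≤⟨ codeg-branch ⊥ cover ⟩
          sumOn K (codeg ∘ ⟪_⟫)           ≤⟨ sumOn-bound K max ⟩
          ∣ K ∣ * codeg ⟪ a ⟫             ≤⟨ *-monoʳ-≤ ∣ K ∣ deg≤ ⟩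
          ∣ K ∣ * (σ * (r * N))           ≡⟨ *-assoc ∣ K ∣ σ _ ⟨
          ∣ K ∣ * σ * (r * N)             ≤⟨ *-monoˡ-≤ (r * N) (product-≤ ∣ K ∣ σ ρ²≤3r σ²≤3r) ⟩
          3 * r * (r * N)                 ≡⟨ *-assoc 3 r _ ⟩
          3 * (r * (r * N))               ∎

    kernelless : Fin n → OreDegree≤ H (r * D)
    -- Any edge can serve as `A`; one missing `v` is at hand.
    kernelless v with avoid-vertex v
    ... | A , A∈H , _ = finish A∈H (λ x∈A → x∈A)
      (r≤∣∁T∣ A (≤-trans (≤-reflexive (∣edge∣ A∈H)) (≤-trans (m≤m+n r _) (m≤m+n _ 1))))
      (≤-trans (sum-codeg-≤ (∁ A) (r ∸ 1) one-in-A)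
        (≤-trans (*-monoʳ-≤ (r ∸ 1) size-≤)
          (kernelless-average ∣ ∁ A ∣ r-n (∣∁T∣-≥ A (≤-reflexive (∣edge∣ A∈H))))))
      where
      one-in-A : ∀ {e} → e ∈E H → sumOn (∁ A) (ind e) ≤ r ∸ 1
      one-in-A {e} e∈H with intersecting A∈H e∈H
      ... | y , y∈ with x∈p∩q⁻ A e y∈
      ...   | y∈A , y∈e = subst (λ s → sumOn (∁ A) (ind e) ≤ s ∸ 1) (∣edge∣ e∈H) (outside-one y∈A y∈e)

  -- Case distinction on the covering pairs

  pair-cover-at? : ∀ a b → Dec (∃ λ x → x ≢ b × Cover ⟪ a & x ⟫)
  pair-cover-at? a b = any? (λ x → ¬? (x ≟ b) ×-dec cover? ⟪ a & x ⟫)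

  cherry-or-triangle : ∀ {a b x} → Cover ⟪ a & b ⟫ → x ≢ b → Cover ⟪ a & x ⟫ → OreDegree≤ H (r * D)
  cherry-or-triangle {a} {b} {x} ab x≢b ax with cover? ⟪ b & x ⟫
  ... | yes bx = triangle ab ax bx
  ... | no ¬bx = cherry ab ax (≢-sym x≢b) ¬bx

  oreDegree-≤ : Fin n → OreDegree≤ H (r * D)
  -- The search may run over all `a` and `b`, since by `pair-cover-≢` a covering pair always has
  -- distinct vertices.
  oreDegree-≤ v with any? (λ a → any? (λ b → cover? ⟪ a & b ⟫))
  ... | no none = kernelless (λ _ xy → none (_ , _ , xy)) v
  ... | yes (a , b , ab) with pair-cover-at? a b | pair-cover-at? b a
  ...   | yes (x , x≢b , ax) | _ = cherry-or-triangle ab x≢b ax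
  ...   | _ | yes (x , x≢a , bx) = cherry-or-triangle (pair-cover-sym ab) x≢a bx
  ...   | no ¬ax | no ¬bx = single-edge ab (λ _ x≢b ax → ¬ax (_ , x≢b , ax)) (λ x≢a _ bx → ¬bx (_ , x≢a , bx))

theorem1p5 : (r n : ℕ) → 3 ≤ r → 4 * r ^ 2 ≤ n → (H : Hypergraph n r) →
    Intersecting H → NonTrivial H →
    OreDegree≤ H (r * (((n ∸ 2) C (r ∸ 2)) ∸ ((n ∸ r ∸ 2) C (r ∸ 2))))
theorem1p5 r n 3≤r 4r²≤n H intersecting nonTrivial =
  oreDegree-≤ H intersecting nonTrivial r-n (vertex r-n)
  where
  r-n = mkLarge 3≤r 4r²≤n
  vertex : ∀ {r n} → Large r n → Fin n
  vertex (large _ _ _ _) = zero
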